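{- Let $\bar X_n$ be the number of descendants of a node chosen uniformly at random from the inserted nodes $\{1,\dots,n\}$ of a random ordered increasing $k$-tree of size $n\ge1$. Then for $m\ge1$, \[ \mathbb{P}\{\bar X_n=m\}=\frac{\binom{m-1-\frac1{k+1}}{m-1}}{n\binom{n-\frac{k}{k+1}}{n}}\sum_{\ell=0}^{m-1}\frac{\binom{m-1}{\ell}(-1)^\ell}{(k+1)(\ell+1)+k}\left(\binom{n+\frac1{k+1}}{n}-\binom{n-\ell-2+\frac2{k+1}}{n}\right). \] As $n\to\infty$, $\bar X_n$ converges in distribution to a discrete random variable $\bar X$ with \[ \mathbb{P}\{\bar X=m\}=\frac{k}{(k+1)(m+\frac{k}{k+1})(m-\frac1{k+1})},\quad m\ge1. \]
   Context: Fix an integer $k\ge1$. An ordered increasing $k$-tree of size $n\ge0$ is built as follows. Start with the root-clique $K_0$: $k$ pairwise adjacent vertices labelled $0_1,\dots,0_k$ (the root nodes; each label $0_\ell$ has value $0$). For $j=1,\dots,n$ in turn, node $j$ is inserted by choosing a currently existing $k$-clique $K$ and attaching $j$ to it, i.e. adding edges from $j$ to all $k$ vertices of $K$; $j$ is then a child of $K$ and the vertices of $K$ are the parents of $j$. The $k$-cliques available for attachment are the root-clique and, for every previously inserted node $x$ attached to a clique $K'$, the $k$ cliques $\{x\}\cup(K'\setminus\{w\})$, $w\in K'$. The children of each $k$-clique are linearly ordered: if $K$ currently has $d^+(K)$ children, there are $d^+(K)+1$ positions at which the new child may be placed, and the choice of position is part of the structure. Thus there are $1+(k+1)(j-1)$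 ways to insert node $j$, and distinct sequences of choices give distinct trees. A random ordered increasing $k$-tree of size $n$ is one chosen uniformly among all of them; equivalently, it is produced by the process in which node $n$ is attached to the clique $K$ with probability $\frac{d^+(K)+1}{1+(k+1)(n-1)}$ (and a uniformly random position among the $d^+(K)+1$). A node $w$ is a descendant of $u$ if $w=u$ or some parent of $w$ is a descendant of $u$ (so $u$ counts as its own descendant). For real $x$ and integer $m\ge0$, $\binom{x}{m}=x(x-1)\cdots(x-m+1)/m!$, and $\binom{x}{m}=0$ for $m<0$. -}

module Defs where

open import Data.Bool.Base using (if_then_else_)
open import Data.Fin.Base as Fin using (Fin; zero; suc; toℕ)
import Data.Fin.Properties as Fin
open import Data.Integer.Base as ℤ using (+_; -[1+_])
import Data.Integer.Properties as ℤ
open import Data.List.Base as List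
  using (List; []; _∷_; _++_; length; filter; concatMap; splitAt; allFin)
open import Data.List.Membership.Propositional using (_∈_; lose)
open import Data.List.Membership.Propositional.Properties
  using (∈-map⁺; ∈-map⁻; ∈-allFin; ∈-concatMap⁺; ∈-++⁺ˡ; ∈-++⁺ʳ)
import Data.List.Relation.Unary.All as All
import Data.List.Relation.Unary.All.Properties as All
import Data.List.Relation.Unary.AllPairs as AllPairs
import Data.List.Relation.Unary.AllPairs.Properties as AllPairs
open import Data.List.Relation.Unary.Any using (here)
open import Data.List.Relation.Unary.Unique.Propositional using (Unique)
import Data.List.Relation.Unary.Unique.Propositional.Properties as Unique
open import Data.Nat.Base as ℕ using (ℕ; zero; suc; pred; NonZero; _!)
import Data.Nat.Properties as ℕ
open import Data.Product.Base using (Σ; ∃-syntax; _×_; _,_)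
open import Data.Product.Properties using (,-injectiveˡ)
open import Data.Rational.Base
  using (ℚ; 0ℚ; 1ℚ; _/_; _+_; _*_; _-_; -_; _≤_; _<_; ∣_∣; floor; Positive; positive)
  renaming (NonZero to NonZeroℚ)
import Data.Rational.Base as ℚ
import Data.Rational.Properties as ℚ
import Data.Rational.Unnormalised.Base as ℚᵘ
import Data.Rational.Unnormalised.Properties as ℚᵘ
open import Data.Sum.Base as Sum using (_⊎_; inj₁; inj₂)
open import Data.Sum.Properties using (≡-dec; inj₁-injective; inj₂-injective)
open import Data.Vec.Base as Vec using (Vec; _[_]≔_; tabulate)
open import Data.Vec.Membership.Propositional using (find) renaming (_∈_ to _∈ᵛ_; lose to loseᵛ)
import Data.Vec.Membership.Propositional.Properties as Vec
import Data.Vec.Relation.Unary.Any as VecAny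
import Data.Vec.Relation.Unary.Any.Properties as VecAny
open import Level using (0ℓ)
open import Relation.Binary.Definitions using (DecidableEquality)
open import Relation.Binary.PropositionalEquality
open import Relation.Nullary using (Dec; yes; no; ¬_; does)
open import Relation.Nullary.Decidable using (map′)
open import Relation.Unary using (Pred; Decidable)

------------------------------------------------------------------------

-- Root nodes 0_ℓ are inj₁ ℓ.  Inserted nodes are counted by age: in a
-- tree of size n, node j is inj₂ i with toℕ i ≡ n ∸ j, so that inj₂ zero
-- is the most recently inserted node.
Vertex : ℕ → ℕ → Set
Vertex k n = Fin k ⊎ Fin n

older : ∀ {k n} → Vertex k n → Vertex k (suc n)
older = Sum.map₂ suc

-- Names of the cliques available for attachment.  If the latest node x was
-- attached to K′, then new i names {x} ∪ (K′ ∖ {w}) for w the i-th vertex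
-- of K′.
data Clique (k : ℕ) : ℕ → Set where
  root : Clique k 0
  old  : ∀ {n} → Clique k n → Clique k (suc n)
  new  : ∀ {n} → Fin k → Clique k (suc n)

infix 4 _≟ᶜ_
_≟ᶜ_ : ∀ {k n} → DecidableEquality (Clique k n)
root  ≟ᶜ root  = yes refl
old K ≟ᶜ old L = map′ (cong old) (λ where refl → refl) (K ≟ᶜ L)
old _ ≟ᶜ new _ = no λ ()
new _ ≟ᶜ old _ = no λ ()
new i ≟ᶜ new j = map′ (cong new) (λ where refl → refl) (i Fin.≟ j)

-- A tree is its sequence of choices: distinct sequences give distinct trees.
-- The new child lands between the first p children of K and the rest.
data Tree (k : ℕ) : ℕ → Set

children : ∀ {k n} → Tree k n → Clique k n → List (Fin n)

data Tree k where
  root   : Tree k 0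
  insert : ∀ {n} (T : Tree k n) (K : Clique k n)
           (p : Fin (suc (length (children T K)))) → Tree k (suc n)

children root           root    = []
children (insert T K p) (new _) = []
children (insert T K p) (old L) =
  if does (K ≟ᶜ L)
  then (let before , after = splitAt (toℕ p) (children T K)
        in List.map suc before ++ zero ∷ List.map suc after)
  else List.map suc (children T L)

vertices : ∀ {k n} → Tree k n → Clique k n → Vec (Vertex k n) k
vertices root           root    = tabulate inj₁
vertices (insert T K p) (old L) = Vec.map older (vertices T L)
vertices (insert T K p) (new i) = Vec.map older (vertices T K) [ i ]≔ inj₂ zero

parents : ∀ {k n} → Tree k n → Fin n → Vec (Vertex k n) k
parents (insert T K p) zero    = Vec.map older (vertices T K)
parents (insert T K p) (suc x) = Vec.map older (parents T x)

-- Descendant T u w: w is a descendant of u.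
data Descendant {k n} (T : Tree k n) (u : Vertex k n) : Vertex k n → Set where
  self  : Descendant T u u
  child : ∀ {v x} → v ∈ᵛ parents T x → Descendant T u v → Descendant T u (inj₂ x)

∈ᵛ-map⁻ : ∀ {A B : Set} {n} (f : A → B) {xs : Vec A n} {y} →
          y ∈ᵛ Vec.map f xs → ∃[ x ] x ∈ᵛ xs × y ≡ f x
∈ᵛ-map⁻ f y∈ = find (VecAny.map⁻ y∈)

older-injective : ∀ {k n} {u w : Vertex k n} → older u ≡ older w → u ≡ w
older-injective {u = inj₁ _} {inj₁ _} refl = refl
older-injective {u = inj₂ _} {inj₂ _} refl = refl

module _ {k n} {T : Tree k n} {K : Clique k n}
         {p : Fin (suc (length (children T K)))} where

  private
    T⁺ = insert T K p

  older⁺ : ∀ {u w} → Descendant T u w → Descendant T⁺ (older u) (older w)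
  older⁺ self        = self
  older⁺ (child m d) = child (Vec.∈-map⁺ older m) (older⁺ d)

  older⁻ : ∀ {u v} w → v ≡ older w → Descendant T⁺ (older u) v → Descendant T u w
  older⁻ w eq self = subst (Descendant T _) (older-injective eq) self
  older⁻ (inj₂ y) refl (child m d) 
    with (v , v∈ , v≡) ← ∈ᵛ-map⁻ older {xs = parents T y} m =
    child v∈ (older⁻ v v≡ d)

  zero-not-above : ∀ {v} w → v ≡ older w → ¬ Descendant T⁺ (inj₂ zero) v
  zero-not-above (inj₁ _) () self
  zero-not-above (inj₂ _) () self
  zero-not-above (inj₂ y) refl (child m d)
    with (v , _ , v≡) ← ∈ᵛ-map⁻ older {xs = parents T y} m =
    zero-not-above v v≡ d

  viaParents : ∀ u → Dec (VecAny.Any (Descendant T u) (vertices T K)) →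
               ¬ older u ≡ inj₂ zero → Dec (Descendant T⁺ (older u) (inj₂ zero))
  viaParents u (yes a) _ with (v , v∈ , d) ← find a =
    yes (child (Vec.∈-map⁺ older v∈) (older⁺ d))
  viaParents u (no ¬a) u≢ = no (refute refl)
    where
    refute : ∀ {v} → v ≡ inj₂ zero → ¬ Descendant T⁺ (older u) v
    refute eq self = u≢ eq
    refute refl (child m d)
      with (v , v∈ , refl) ← ∈ᵛ-map⁻ older {xs = vertices T K} m =
      ¬a (loseᵛ v∈ (older⁻ v refl d))

descendant? : ∀ {k n} (T : Tree k n) (u : Vertex k n) → Decidable (Descendant T u)
descendant? T u (inj₁ ℓ) with ≡-dec Fin._≟_ Fin._≟_ u (inj₁ ℓ)
... | yes refl = yes self
... | no u≢    = no λ where self → u≢ refl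
descendant? (insert T K p) (inj₂ zero) (inj₂ zero)    = yes self
descendant? (insert T K p) (inj₁ ℓ) (inj₂ zero) =
  viaParents (inj₁ ℓ) (VecAny.any? (descendant? T (inj₁ ℓ)) (vertices T K)) λ ()
descendant? (insert T K p) (inj₂ (suc u)) (inj₂ zero) =
  viaParents (inj₂ u) (VecAny.any? (descendant? T (inj₂ u)) (vertices T K)) λ ()
descendant? (insert T K p) (inj₂ zero) (inj₂ (suc x)) =
  no (zero-not-above (inj₂ x) refl)
descendant? (insert T K p) (inj₁ ℓ) (inj₂ (suc x)) =
  map′ older⁺ (older⁻ (inj₂ x) refl) (descendant? T (inj₁ ℓ) (inj₂ x))
descendant? (insert T K p) (inj₂ (suc u)) (inj₂ (suc x)) =
  map′ older⁺ (older⁻ (inj₂ x) refl) (descendant? T (inj₂ u) (inj₂ x))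

------------------------------------------------------------------------

record Enumeration (A : Set) : Set where
  field
    elements : List A
    unique   : Unique elements
    complete : ∀ a → a ∈ elements

  size : ℕ
  size = length elements

open Enumeration

count : ∀ {A} → Enumeration A → {P : Pred A 0ℓ} → Decidable P → ℕ
count E P? = length (filter P? (elements E))

size≢0 : ∀ {A} (E : Enumeration A) → A → NonZero (size E)
size≢0 E a with elements E | complete E a
... | _ ∷ _ | _ = _

ℙ : ∀ {A} (E : Enumeration A) .{{_ : NonZero (size E)}} →
    {P : Pred A 0ℓ} → Decidable P → ℚ
ℙ E P? = + count E P? / size E

finEnum : ∀ n → Enumeration (Fin n)
finEnum n = record
  { elements = allFin n ; unique = Unique.allFin⁺ n ; complete = ∈-allFin }

mapEnum : ∀ {A B : Set} (f : A → B) → (∀ {x y} → f x ≡ f y → x ≡ y) →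
          (∀ b → ∃[ a ] f a ≡ b) → Enumeration A → Enumeration B
mapEnum f inj surj E = record
  { elements = List.map f (elements E)
  ; unique   = Unique.map⁺ inj (unique E)
  ; complete = λ b → let a , fa≡b = surj b in
      subst (_∈ _) fa≡b (∈-map⁺ f (complete E a))
  }

⊎-enum : ∀ {A B : Set} → Enumeration A → Enumeration B → Enumeration (A ⊎ B)
⊎-enum E F = record
  { elements = List.map inj₁ (elements E) ++ List.map inj₂ (elements F)
  ; unique   = Unique.++⁺ (Unique.map⁺ inj₁-injective (unique E))
                          (Unique.map⁺ inj₂-injective (unique F)) disjoint
  ; complete = λ where
      (inj₁ a) → ∈-++⁺ˡ (∈-map⁺ inj₁ (complete E a))
      (inj₂ b) → ∈-++⁺ʳ _ (∈-map⁺ inj₂ (complete F b))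
  }
  where
  disjoint : ∀ {v} → ¬ (v ∈ List.map inj₁ (elements E) × v ∈ List.map inj₂ (elements F))
  disjoint (l , r) with ∈-map⁻ inj₁ l | ∈-map⁻ inj₂ r
  ... | _ , _ , refl | _ , _ , ()

Σ-enum : ∀ {A : Set} {B : A → Set} → Enumeration A → (∀ a → Enumeration (B a)) →
         Enumeration (Σ A B)
Σ-enum {A} {B} E F = record
  { elements = concatMap row (elements E)
  ; unique   = Unique.concat⁺
      (All.map⁺ (All.universal (λ a → Unique.map⁺ (λ where refl → refl) (unique (F a))) _))
      (AllPairs.map⁺ (AllPairs.map disjoint (unique E)))
  ; complete = λ (a , b) →
      ∈-concatMap⁺ row (lose (complete E a) (∈-map⁺ (a ,_) (complete (F a) b)))
  }
  where
  row : A → List (Σ A B)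
  row a = List.map (a ,_) (elements (F a))
  disjoint : ∀ {a a′} → ¬ a ≡ a′ → ∀ {v} → ¬ (v ∈ row a × v ∈ row a′)
  disjoint a≢ (l , r) with ∈-map⁻ _ l | ∈-map⁻ _ r
  ... | _ , _ , refl | _ , _ , eq = a≢ (,-injectiveˡ eq)

vertexEnum : ∀ k n → Enumeration (Vertex k n)
vertexEnum k n = ⊎-enum (finEnum k) (finEnum n)

cliqueEnum : ∀ k n → Enumeration (Clique k n)
cliqueEnum k zero    = record
  { elements = root ∷ []
  ; unique   = All.[] AllPairs.∷ AllPairs.[]
  ; complete = λ where root → here refl
  }
cliqueEnum k (suc n) =
  mapEnum f f-inj f-surj (⊎-enum (cliqueEnum k n) (finEnum k))
  where
  f : Clique k n ⊎ Fin k → Clique k (suc n)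
  f = Sum.[ old , new ]
  f-inj : ∀ {x y} → f x ≡ f y → x ≡ y
  f-inj {inj₁ _} {inj₁ _} refl = refl
  f-inj {inj₂ _} {inj₂ _} refl = refl
  f-surj : ∀ K → ∃[ x ] f x ≡ K
  f-surj (old K) = inj₁ K , refl
  f-surj (new i) = inj₂ i , refl

treeEnum : ∀ k n → Enumeration (Tree k n)
treeEnum k zero    = record
  { elements = root ∷ []
  ; unique   = All.[] AllPairs.∷ AllPairs.[]
  ; complete = λ where root → here refl
  }
treeEnum k (suc n) =
  mapEnum (λ (T , K , p) → insert T K p) (λ where refl → refl)
    (λ where (insert T K p) → (T , K , p) , refl)
    (Σ-enum (treeEnum k n) λ T →
     Σ-enum (cliqueEnum k n) λ K →
     finEnum (suc (length (children T K))))

------------------------------------------------------------------------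

-- The uniform distribution here is a uniform tree and, independently, a
-- uniform inserted node of it.
Ω : ℕ → ℕ → Set
Ω k n = Tree k n × Fin n

ΩEnum : ∀ k n → Enumeration (Ω k n)
ΩEnum k n = Σ-enum (treeEnum k n) (λ _ → finEnum n)

descendants : ∀ {k n} → Ω k n → ℕ
descendants {k} {n} (T , u) = count (vertexEnum k n) (descendant? T (inj₂ u))

rootClique : ∀ k n → Clique k n
rootClique k zero    = root
rootClique k (suc n) = old (rootClique k n)

someTree : ∀ k n → Tree k n
someTree k zero    = root
someTree k (suc n) = insert (someTree k n) (rootClique k n) zero

ΩEnum≢0 : ∀ k n .{{_ : NonZero n}} → NonZero (size (ΩEnum k n))
ΩEnum≢0 k (suc n) = size≢0 (ΩEnum k (suc n)) (someTree k (suc n) , zero)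

-- law k n m is the probability that X̄ₙ ≡ m.
law : ∀ k n .{{_ : NonZero n}} → ℕ → ℚ
law k n m = ℙ (ΩEnum k n) {{ΩEnum≢0 k n}} (λ ω → descendants ω ℕ.≟ m)

------------------------------------------------------------------------

fromℕ : ℕ → ℚ
fromℕ n = + n / 1

∑< : ℕ → (ℕ → ℚ) → ℚ
∑< zero    f = 0ℚ
∑< (suc n) f = ∑< n f + f n

infixr 6 ∑<
syntax ∑< n (λ i → e) = ∑[ i < n ] e

falling : ℚ → ℕ → ℚ
falling x zero    = 1ℚ
falling x (suc m) = falling x m * (x - fromℕ m)

binom : ℚ → ℕ → ℚ
binom x m = falling x m * (+ 1 / m !) {{m ℕ.!≢0}}

------------------------------------------------------------------------

infix 4 _⟶_ _⟶ᵈ_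

_⟶_ : ((n : ℕ) .{{_ : NonZero n}} → ℚ) → ℚ → Set
s ⟶ L = ∀ ε → 0ℚ < ε → ∃[ N ] ∀ n .{{_ : NonZero n}} → N ℕ.≤ n → ∣ s n - L ∣ < ε

record IsProbabilityMass (μ : ℕ → ℚ) : Set where
  field
    nonNegative : ∀ m → 0ℚ ≤ μ m
    total       : (λ n → ∑[ m < n ] μ m) ⟶ 1ℚ

cdf : (ℕ → ℚ) → ℚ → ℚ
cdf μ x with floor x
... | + t      = ∑[ m < suc t ] μ m
... | -[1+ _ ] = 0ℚ

ContinuousAt : (ℚ → ℚ) → ℚ → Set
ContinuousAt f x = ∀ ε → 0ℚ < ε →
  ∃[ δ ] 0ℚ < δ × (∀ y → ∣ y - x ∣ < δ → ∣ f y - f x ∣ < ε)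

-- Since the laws live on ℕ, their distribution functions are constant
-- between consecutive integers, so rational arguments suffice.
_⟶ᵈ_ : ((n : ℕ) .{{_ : NonZero n}} → ℕ → ℚ) → (ℕ → ℚ) → Set
μs ⟶ᵈ μ = ∀ x → ContinuousAt (cdf μ) x → (λ n → cdf (μs n) x) ⟶ cdf μ x

------------------------------------------------------------------------

fromℕ-pos : ∀ n .{{_ : NonZero n}} → Positive (fromℕ n)
fromℕ-pos n = ℚ.normalize-pos n 1

fromℕ-suc : ∀ n → fromℕ (suc n) ≡ fromℕ n + 1ℚ
fromℕ-suc n = ℚ.toℚᵘ-injective (begin
  ℚ.toℚᵘ (fromℕ (suc n))                 ≈⟨ ℚ.toℚᵘ-fromℚᵘ (ℚᵘ.mkℚᵘ (+ suc n) 0) ⟩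
  ℚᵘ.mkℚᵘ (+ suc n) 0                    ≈⟨ ℚᵘ.*≡* (cong (ℤ._* + 1) numerators) ⟩
  ℚᵘ.mkℚᵘ (+ n) 0 ℚᵘ.+ ℚᵘ.1ℚᵘ            ≈⟨ ℚᵘ.+-congˡ ℚᵘ.1ℚᵘ (ℚ.toℚᵘ-fromℚᵘ (ℚᵘ.mkℚᵘ (+ n) 0)) ⟨
  ℚ.toℚᵘ (fromℕ n) ℚᵘ.+ ℚ.toℚᵘ 1ℚ        ≈⟨ ℚ.toℚᵘ-homo-+ (fromℕ n) 1ℚ ⟨
  ℚ.toℚᵘ (fromℕ n + 1ℚ)                  ∎)
  where
  open ℚᵘ.≃-Reasoning
  numerators : + suc n ≡ (+ n ℤ.* + 1) ℤ.+ + 1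
  numerators = trans (cong +_ (ℕ.+-comm 1 n)) (cong (ℤ._+ + 1) (sym (ℤ.*-identityʳ (+ n))))

0≤fromℕ : ∀ n → 0ℚ ≤ fromℕ n
0≤fromℕ n = ℚ.nonNegative⁻¹ (fromℕ n) {{ℚ.normalize-nonNeg n 1}}

fromℕ-mono : ∀ {i n} → i ℕ.≤ n → fromℕ i ≤ fromℕ n
fromℕ-mono {n = n} ℕ.z≤n       = 0≤fromℕ n
fromℕ-mono {suc i} {suc n} (ℕ.s≤s i≤n) =
  subst₂ _≤_ (sym (fromℕ-suc i)) (sym (fromℕ-suc n)) (ℚ.+-monoˡ-≤ 1ℚ (fromℕ-mono i≤n))

/-pos : ∀ a b .{{_ : NonZero a}} .{{_ : NonZero b}} → Positive (+ a / b)
/-pos a b = ℚ.normalize-pos a b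

/<1 : ∀ a b → a ℕ.< suc b → + a / suc b < 1ℚ
/<1 a b a<b = ℚ.toℚᵘ-cancel-< (ℚᵘ.<-respˡ-≃ (ℚᵘ.≃-sym (ℚ.toℚᵘ-fromℚᵘ (ℚᵘ.mkℚᵘ (+ a) b)))
  (ℚᵘ.*<* (subst₂ ℤ._<_ (sym (ℤ.*-identityʳ (+ a))) (sym (ℤ.*-identityˡ (+ suc b))) (ℤ.+<+ a<b))))

0<⇒< : ∀ {p q} → p < q → 0ℚ < q - p
0<⇒< {p} {q} p<q = subst (_< q - p) (ℚ.+-inverseʳ p) (ℚ.+-monoˡ-< (- p) p<q)

gap : ∀ q i n → q < 1ℚ → i ℕ.< n → 0ℚ < (fromℕ n - q) - fromℕ i
gap q i n q<1 i<n = 0<⇒< (begin-strict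
  fromℕ i              ≡⟨ ℚ.+-identityʳ (fromℕ i) ⟨
  fromℕ i + 0ℚ         <⟨ ℚ.+-monoʳ-< (fromℕ i) (0<⇒< q<1) ⟩
  fromℕ i + (1ℚ - q)   ≡⟨ ℚ.+-assoc (fromℕ i) 1ℚ (- q) ⟨
  fromℕ i + 1ℚ - q     ≡⟨ cong (_- q) (fromℕ-suc i) ⟨
  fromℕ (suc i) - q    ≤⟨ ℚ.+-monoˡ-≤ (- q) (fromℕ-mono i<n) ⟩
  fromℕ n - q          ∎)
  where open ℚ.≤-Reasoning

falling-pos : ∀ x m → (∀ i → i ℕ.< m → 0ℚ < x - fromℕ i) → Positive (falling x m)
falling-pos x zero    h = _
falling-pos x (suc m) h =
  ℚ.pos*pos⇒pos (falling x m) {{falling-pos x m λ i i<m → h i (ℕ.m<n⇒m<1+n i<m)}}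
                (x - fromℕ m) {{positive (h m (ℕ.n<1+n m))}}

lawDenominator≢0 : ∀ k n .{{_ : NonZero n}} →
  NonZeroℚ (fromℕ n * binom (fromℕ n - + k / suc k) n)
lawDenominator≢0 k n = ℚ.pos⇒nonZero (fromℕ n * binom x n)
  {{ℚ.pos*pos⇒pos (fromℕ n) {{fromℕ-pos n}} (binom x n) {{binom-pos}}}}
  where
  x 1/n! : ℚ
  x    = fromℕ n - + k / suc k
  1/n! = (+ 1 / n !) {{n ℕ.!≢0}}
  binom-pos : Positive (binom x n)
  binom-pos = ℚ.pos*pos⇒pos
    (falling x n) {{falling-pos x n λ i → gap (+ k / suc k) i n (/<1 k k (ℕ.n<1+n k))}}
    1/n!          {{/-pos 1 (n !) {{_}} {{n ℕ.!≢0}}}}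

limitDenominator≢0 : ∀ k .{{_ : NonZero k}} m .{{_ : NonZero m}} →
  NonZeroℚ (fromℕ (suc k) * (fromℕ m + + k / suc k) * (fromℕ m - + 1 / suc k))
limitDenominator≢0 k@(suc k′) m@(suc m′) = ℚ.pos⇒nonZero (a * b * c)
  {{ℚ.pos*pos⇒pos (a * b)
    {{ℚ.pos*pos⇒pos a {{fromℕ-pos (suc k)}} b
      {{ℚ.pos+pos⇒pos (fromℕ m) {{fromℕ-pos m}} (+ k / suc k) {{/-pos k (suc k)}}}}}}
    c {{positive (subst (0ℚ <_) (ℚ.+-identityʳ c)
         (gap (+ 1 / suc k) 0 m (/<1 1 k (ℕ.s≤s (ℕ.s≤s ℕ.z≤n))) (ℕ.s≤s ℕ.z≤n)))}}}}
  where
  a b c : ℚ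
  a = fromℕ (suc k)
  b = fromℕ m + + k / suc k
  c = fromℕ m - + 1 / suc k

{-# OPTIONS --safe #-}

-- Give a clique K the weight d⁺(K) + 1, so that the next node chooses K with
-- probability proportional to its weight.  The total weight is 1 + (k+1) n, and
-- the cliques meeting the set of descendants of a node with d descendants have
-- total weight (k+1) d - 1.  With α = 1/(k+1), the expected number of nodes with
-- m descendants therefore obeys a linear recurrence in n, which the alternating
-- binomial sum satisfies as well.  Up to the factor n + α, the limit law μ is an
-- exact solution of this recurrence.  The cumulative deviation from it evolves by
-- convex combinations once n exceeds the number of descendants, hence stays
-- bounded, and the distribution functions converge at rate 1/n.

module Submission where

open import Defs
open Enumeration
open import Data.Nat.Base as ℕ using (ℕ; zero; suc; pred; NonZero; _!)
import Data.Nat.Properties as ℕ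
open import Data.Product.Base using (Σ; ∃-syntax; Σ-syntax; _×_; _,_)
open import Level using (0ℓ)
open import Relation.Binary.PropositionalEquality

-- For a fixed size the recurrence is first order in n and forced only by the next smaller size, so
-- the system is triangular. Multiplying by the integrating factor `H` turns the divisor n+α into
-- n+1; the homogeneous equation for size ℓ+1 then has the coefficient n-1-ℓ+2α and the solution
-- binom (n-ℓ-2+2α) n. This is the origin of the second binomial in the formula. The first one,
-- binom (n+α) n, is proportional to the leaf term, and the two agree at n = 0, where the expected
-- counts vanish. The limit is read off the recurrence and not off the closed form. Convergence in
-- distribution concerns partial sums, and summed over all sizes up to t+1 the recurrence
-- simplifies: a node leaves this range only from size t+1, with rate s = t+1-α, so that only the
-- coefficients n+α-s and s remain, and these add up to n+α. The counting is done in ℕ, over all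
-- trees at once; terms with a minus sign stand on the opposite side until the passage to ℚ.

module Counting where

  open import Data.Bool.Base using (if_then_else_)
  open import Data.Empty using (⊥-elim)
  open import Data.Fin.Base using (Fin; zero; suc; toℕ)
  open import Data.List.Base as List using (List; []; _∷_; _++_; length; filter; concatMap; allFin)
  open import Data.List.Membership.Propositional using (_∈_)
  import Data.List.Properties as List
  open import Data.List.Relation.Unary.All as All using (All)
  open import Data.List.Relation.Unary.AllPairs using (_∷_)
  open import Data.List.Relation.Unary.Any using (here; there)
  open import Data.List.Relation.Unary.Unique.Propositional using (Unique)
  open import Data.Nat.Base using (_+_; _*_)
  open import Data.Nat.ListAction using (sum)
  open import Data.Nat.Tactic.RingSolver using (solve-∀)
  open import Data.Sum.Base using (_⊎_; inj₁; inj₂)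
  open import Data.Vec.Base as Vec using (Vec; _[_]≔_)
  open import Data.Vec.Membership.Propositional using (find) renaming (_∈_ to _∈ᵛ_; lose to loseᵛ)
  import Data.Vec.Membership.Propositional.Properties as Vec
  import Data.Vec.Properties as Vec
  import Data.Vec.Relation.Unary.Any as VecAny
  import Data.Vec.Relation.Unary.Any.Properties as VecAny
  open import Relation.Binary.Definitions using (DecidableEquality)
  open import Relation.Nullary using (Dec; yes; no; ¬_; does)
  open import Relation.Unary using (Pred; Decidable)
  open ≡-Reasoning

  private
    variable
      A B P Q : Set
      k n : ℕ

  -- Indicator sums over lists and enumerations.

  𝟙 : Dec P → ℕ
  𝟙 p? = if does p? then 1 else 0

  𝟙-yes : (p? : Dec P) → P → 𝟙 p? ≡ 1
  𝟙-yes (yes _) p = refl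
  𝟙-yes (no ¬p) p = ⊥-elim (¬p p)

  𝟙-no : (p? : Dec P) → ¬ P → 𝟙 p? ≡ 0
  𝟙-no (yes p) ¬p = ⊥-elim (¬p p)
  𝟙-no (no _)  ¬p = refl

  𝟙-cong : (p? : Dec P) (q? : Dec Q) → (P → Q) → (Q → P) → 𝟙 p? ≡ 𝟙 q?
  𝟙-cong (yes p) q? f g = sym (𝟙-yes q? (f p))
  𝟙-cong (no ¬p) q? f g = sym (𝟙-no q? (λ q → ¬p (g q)))

  ∑ᴸ : List A → (A → ℕ) → ℕ
  ∑ᴸ xs f = sum (List.map f xs)

  ∑ᴸ-cong : ∀ (xs : List A) {f g : A → ℕ} → (∀ x → f x ≡ g x) → ∑ᴸ xs f ≡ ∑ᴸ xs g
  ∑ᴸ-cong xs f≗g = cong sum (List.map-cong f≗g xs)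

  ∑ᴸ-+ : ∀ (xs : List A) f g → ∑ᴸ xs (λ x → f x + g x) ≡ ∑ᴸ xs f + ∑ᴸ xs g
  ∑ᴸ-+ []       f g = refl
  ∑ᴸ-+ (x ∷ xs) f g = trans (cong (f x + g x +_) (∑ᴸ-+ xs f g))
    (interchange (f x) (g x) (∑ᴸ xs f) (∑ᴸ xs g))
    where
    interchange : ∀ a b c d → a + b + (c + d) ≡ a + c + (b + d)
    interchange = solve-∀

  ∑ᴸ-* : ∀ (xs : List A) f c → ∑ᴸ xs (λ x → f x * c) ≡ ∑ᴸ xs f * c
  ∑ᴸ-* []       f c = refl
  ∑ᴸ-* (x ∷ xs) f c = trans (cong (f x * c +_) (∑ᴸ-* xs f c)) (sym (ℕ.*-distribʳ-+ c (f x) _))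

  ∑ᴸ-const : ∀ (xs : List A) c → ∑ᴸ xs (λ _ → c) ≡ length xs * c
  ∑ᴸ-const []       c = refl
  ∑ᴸ-const (x ∷ xs) c = cong (c +_) (∑ᴸ-const xs c)

  ∑ᴸ-swap : ∀ (xs : List A) (ys : List B) (f : A → B → ℕ) →
            ∑ᴸ xs (λ x → ∑ᴸ ys (f x)) ≡ ∑ᴸ ys (λ y → ∑ᴸ xs (λ x → f x y))
  ∑ᴸ-swap []       ys f = sym (trans (∑ᴸ-const ys 0) (ℕ.*-zeroʳ (length ys)))
  ∑ᴸ-swap (x ∷ xs) ys f = trans (cong (∑ᴸ ys (f x) +_) (∑ᴸ-swap xs ys f))
    (sym (∑ᴸ-+ ys (f x) (λ y → ∑ᴸ xs (λ x → f x y))))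

  ∑ᴸ-++ : ∀ (xs ys : List A) f → ∑ᴸ (xs ++ ys) f ≡ ∑ᴸ xs f + ∑ᴸ ys f
  ∑ᴸ-++ []       ys f = refl
  ∑ᴸ-++ (x ∷ xs) ys f = trans (cong (f x +_) (∑ᴸ-++ xs ys f)) (sym (ℕ.+-assoc (f x) _ _))

  ∑ᴸ-map : ∀ (g : A → B) (xs : List A) f → ∑ᴸ (List.map g xs) f ≡ ∑ᴸ xs (λ x → f (g x))
  ∑ᴸ-map g xs f = cong sum (sym (List.map-∘ xs))

  ∑ᴸ-concatMap : ∀ (g : A → List B) (xs : List A) f →
                 ∑ᴸ (concatMap g xs) f ≡ ∑ᴸ xs (λ x → ∑ᴸ (g x) f)
  ∑ᴸ-concatMap g []       f = refl
  ∑ᴸ-concatMap g (x ∷ xs) f =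
    trans (∑ᴸ-++ (g x) (concatMap g xs) f) (cong (∑ᴸ (g x) f +_) (∑ᴸ-concatMap g xs f))

  length-filter-𝟙 : ∀ {P : Pred A 0ℓ} (P? : Decidable P) xs →
                    length (filter P? xs) ≡ ∑ᴸ xs (λ x → 𝟙 (P? x))
  length-filter-𝟙 P? []       = refl
  length-filter-𝟙 P? (x ∷ xs) with P? x
  ... | yes _ = cong suc (length-filter-𝟙 P? xs)
  ... | no  _ = length-filter-𝟙 P? xs

  -- Uniqueness of the list leaves a single nonzero term. This isolates the contribution of the
  -- clique chosen by an insertion.
  ∑ᴸ-𝟙≟ : ∀ (_≟_ : DecidableEquality A) {xs} → Unique xs → ∀ {x} → x ∈ xs → ∀ (f : A → ℕ) →
          ∑ᴸ xs (λ y → 𝟙 (x ≟ y) * f y) ≡ f x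
  ∑ᴸ-𝟙≟ _≟_ {y ∷ ys} (y∉ys ∷ _) {x} (here refl) f = begin
    𝟙 (x ≟ x) * f x + ∑ᴸ ys (λ y → 𝟙 (x ≟ y) * f y)
      ≡⟨ cong₂ (λ a b → a * f x + b) (𝟙-yes (x ≟ x) refl) (vanish ys y∉ys) ⟩
    1 * f x + 0
      ≡⟨ trans (ℕ.+-identityʳ _) (ℕ.*-identityˡ (f x)) ⟩
    f x ∎
    where
    vanish : ∀ ys → All (λ y → ¬ x ≡ y) ys → ∑ᴸ ys (λ y → 𝟙 (x ≟ y) * f y) ≡ 0
    vanish []       All.[]         = refl
    vanish (y ∷ ys) (x≢y All.∷ ps) =
      cong₂ (λ a b → a * f y + b) (𝟙-no (x ≟ y) x≢y) (vanish ys ps)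
  ∑ᴸ-𝟙≟ _≟_ {y ∷ ys} (y∉ys ∷ u) {x} (there x∈ys) f =
    cong₂ (λ a b → a * f y + b)
      (𝟙-no (x ≟ y) λ x≡y → All.lookup y∉ys x∈ys (sym x≡y)) (∑ᴸ-𝟙≟ _≟_ u x∈ys f)

  ∑ᴱ : Enumeration A → (A → ℕ) → ℕ
  ∑ᴱ E = ∑ᴸ (elements E)

  infixr 5 ∑ᴱ
  syntax ∑ᴱ E (λ a → e) = ∑[ a ∈ E ] e

  ∑ᴱ-cong : ∀ (E : Enumeration A) {f g : A → ℕ} → (∀ x → f x ≡ g x) → ∑ᴱ E f ≡ ∑ᴱ E g
  ∑ᴱ-cong E = ∑ᴸ-cong (elements E)

  count-∑ : ∀ (E : Enumeration A) {P : Pred A 0ℓ} (P? : Decidable P) →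
            count E P? ≡ ∑[ a ∈ E ] 𝟙 (P? a)
  count-∑ E P? = length-filter-𝟙 P? (elements E)

  size-∑ : ∀ (E : Enumeration A) → size E ≡ ∑[ a ∈ E ] 1
  size-∑ E = sym (trans (∑ᴸ-const (elements E) 1) (ℕ.*-identityʳ _))

  ∑-Σ : ∀ {B : A → Set} (E : Enumeration A) (F : ∀ a → Enumeration (B a)) f →
        ∑ᴱ (Σ-enum E F) f ≡ ∑[ a ∈ E ] ∑[ b ∈ F a ] f (a , b)
  ∑-Σ E F f = trans (∑ᴸ-concatMap _ (elements E) f)
    (∑ᴸ-cong (elements E) λ a → ∑ᴸ-map (a ,_) (elements (F a)) f)

  ∑-⊎ : ∀ (E : Enumeration A) (F : Enumeration B) f →
        ∑ᴱ (⊎-enum E F) f ≡ (∑[ a ∈ E ] f (inj₁ a)) + (∑[ b ∈ F ] f (inj₂ b))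
  ∑-⊎ E F f = trans (∑ᴸ-++ (List.map inj₁ (elements E)) _ f)
    (cong₂ _+_ (∑ᴸ-map inj₁ (elements E) f) (∑ᴸ-map inj₂ (elements F) f))

  ∑-Fin-const : ∀ n c → ∑[ i ∈ finEnum n ] c ≡ n * c
  ∑-Fin-const n c = trans (∑ᴸ-const (allFin n) c) (cong (_* c) (List.length-tabulate {n = n} λ i → i))

  ∑-Fin-suc : ∀ n f → ∑ᴱ (finEnum (suc n)) f ≡ f zero + (∑[ i ∈ finEnum n ] f (suc i))
  ∑-Fin-suc n f = cong (f zero +_) (begin
    sum (List.map f (List.tabulate suc))              ≡⟨ cong sum (List.map-tabulate suc f) ⟩
    sum (List.tabulate (λ i → f (suc i)))             ≡⟨ cong sum (List.map-tabulate (λ i → i) (λ i → f (suc i))) ⟨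
    sum (List.map (λ i → f (suc i)) (allFin n))       ∎)

  ∑-vertices : ∀ k n f → ∑ᴱ (vertexEnum k (suc n)) f ≡
               f (inj₂ zero) + (∑[ v ∈ vertexEnum k n ] f (older v))
  ∑-vertices k n f = begin
    ∑ᴱ (vertexEnum k (suc n)) f
      ≡⟨ ∑-⊎ (finEnum k) (finEnum (suc n)) f ⟩
    a + ∑ᴱ (finEnum (suc n)) (λ i → f (inj₂ i))
      ≡⟨ cong (a +_) (∑-Fin-suc n (λ i → f (inj₂ i))) ⟩
    a + (f (inj₂ zero) + b)
      ≡⟨ rotate a (f (inj₂ zero)) b ⟩
    f (inj₂ zero) + (a + b)
      ≡⟨ cong (f (inj₂ zero) +_) (∑-⊎ (finEnum k) (finEnum n) (λ v → f (older v))) ⟨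
    f (inj₂ zero) + (∑[ v ∈ vertexEnum k n ] f (older v)) ∎
    where
    a b : ℕ
    a = ∑[ i ∈ finEnum k ] f (inj₁ i)
    b = ∑[ i ∈ finEnum n ] f (inj₂ (suc i))
    rotate : ∀ x y z → x + (y + z) ≡ y + (x + z)
    rotate = solve-∀

  ∑-cliques : ∀ k n f → ∑ᴱ (cliqueEnum k (suc n)) f ≡
              (∑[ K ∈ cliqueEnum k n ] f (old K)) + (∑[ i ∈ finEnum k ] f (new i))
  ∑-cliques k n f = trans (∑ᴸ-map _ (elements (⊎-enum (cliqueEnum k n) (finEnum k))) f)
    (∑-⊎ (cliqueEnum k n) (finEnum k) _)

  -- Weights of cliques under insertion.

  weight : Tree k n → Clique k n → ℕ
  weight T K = suc (length (children T K))

  -- The innermost sum is the source of preferential attachment: when `f` does not depend on `p`, it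
  -- multiplies the term of `K` by `weight T K`.
  ∑-trees : ∀ k n f → ∑ᴱ (treeEnum k (suc n)) f ≡
            ∑[ T ∈ treeEnum k n ] ∑[ K ∈ cliqueEnum k n ] ∑[ p ∈ finEnum (weight T K) ] f (insert T K p)
  ∑-trees k n f = begin
    ∑ᴱ (treeEnum k (suc n)) f
      ≡⟨ ∑ᴸ-map _ (elements (Σ-enum (treeEnum k n) positions)) f ⟩
    ∑ᴱ (Σ-enum (treeEnum k n) positions) (λ (T , K , p) → f (insert T K p))
      ≡⟨ ∑-Σ (treeEnum k n) positions _ ⟩
    ∑[ T ∈ treeEnum k n ] ∑ᴱ (positions T) (λ (K , p) → f (insert T K p))
      ≡⟨ ∑ᴱ-cong (treeEnum k n) (λ T → ∑-Σ (cliqueEnum k n) (λ K → finEnum (weight T K)) _) ⟩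
    (∑[ T ∈ treeEnum k n ] ∑[ K ∈ cliqueEnum k n ] ∑[ p ∈ finEnum (weight T K) ] f (insert T K p)) ∎
    where
    positions : (T : Tree k n) → Enumeration (Σ (Clique k n) λ K → Fin (weight T K))
    positions T = Σ-enum (cliqueEnum k n) λ K → finEnum (weight T K)

  ∑-Ω : ∀ k n (f : Ω k n → ℕ) → ∑ᴱ (ΩEnum k n) f ≡
        ∑[ T ∈ treeEnum k n ] ∑[ u ∈ finEnum n ] f (T , u)
  ∑-Ω k n f = ∑-Σ (treeEnum k n) (λ _ → finEnum n) f

  -- Cutting the children of `K` at `p` and rejoining them around the new child loses none of them,
  -- so the position has no influence on the weights.
  length-children-old : ∀ (T : Tree k n) K p L →
    length (children (insert T K p) (old L)) ≡ length (children T L) + 𝟙 (K ≟ᶜ L)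
  length-children-old T K p L with K ≟ᶜ L
  ... | no  _    = trans (List.length-map suc (children T L)) (sym (ℕ.+-identityʳ _))
  ... | yes refl rewrite List.splitAt-defn (toℕ p) (children T K) = begin
    length (List.map suc before ++ zero ∷ List.map suc after)
      ≡⟨ List.length-++ (List.map suc before) ⟩
    length (List.map suc before) + suc (length (List.map suc after))
      ≡⟨ cong₂ (λ a b → a + suc b) (List.length-map suc before) (List.length-map suc after) ⟩
    length before + suc (length after)
      ≡⟨ trans (ℕ.+-suc _ _) (sym (ℕ.+-comm _ 1)) ⟩
    length before + length after + 1
      ≡⟨ cong (_+ 1) (List.length-++ before) ⟨
    length (before ++ after) + 1
      ≡⟨ cong (λ xs → length xs + 1) (List.take++drop≡id (toℕ p) (children T K)) ⟩
    length (children T K) + 1 ∎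
    where
    before after : List (Fin _)
    before = List.take (toℕ p) (children T K)
    after  = List.drop (toℕ p) (children T K)

  -- An insertion raises the weight of the chosen clique K by one and creates
  -- k cliques of weight one.
  ∑-weight-insert : ∀ (T : Tree k n) K p (f : Clique k (suc n) → ℕ) →
    (∑[ L ∈ cliqueEnum k (suc n) ] weight (insert T K p) L * f L) ≡
    (∑[ L ∈ cliqueEnum k n ] weight T L * f (old L)) + f (old K) + (∑[ i ∈ finEnum k ] f (new i))
  ∑-weight-insert {k} {n} T K p f = begin
    (∑[ L ∈ cliqueEnum k (suc n) ] weight (insert T K p) L * f L)
      ≡⟨ ∑-cliques k n _ ⟩
    (∑[ L ∈ cliqueEnum k n ] weight (insert T K p) (old L) * f (old L)) + (∑[ i ∈ finEnum k ] 1 * f (new i))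
      ≡⟨ cong₂ _+_ (∑ᴱ-cong (cliqueEnum k n) split) (∑ᴱ-cong (finEnum k) λ i → ℕ.*-identityˡ (f (new i))) ⟩
    (∑[ L ∈ cliqueEnum k n ] weight T L * f (old L) + 𝟙 (K ≟ᶜ L) * f (old L)) + (∑[ i ∈ finEnum k ] f (new i))
      ≡⟨ cong (_+ _) (∑ᴸ-+ (elements (cliqueEnum k n)) _ _) ⟩
    (∑[ L ∈ cliqueEnum k n ] weight T L * f (old L)) + (∑[ L ∈ cliqueEnum k n ] 𝟙 (K ≟ᶜ L) * f (old L)) + (∑[ i ∈ finEnum k ] f (new i))
      ≡⟨ cong (λ s → (∑[ L ∈ cliqueEnum k n ] weight T L * f (old L)) + s + _)
           (∑ᴸ-𝟙≟ _≟ᶜ_ (unique (cliqueEnum k n)) (complete (cliqueEnum k n) K) (λ L → f (old L))) ⟩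
    (∑[ L ∈ cliqueEnum k n ] weight T L * f (old L)) + f (old K) + (∑[ i ∈ finEnum k ] f (new i)) ∎
    where
    split : ∀ L → weight (insert T K p) (old L) * f (old L) ≡ weight T L * f (old L) + 𝟙 (K ≟ᶜ L) * f (old L)
    split L = trans (cong (λ d → suc d * f (old L)) (length-children-old T K p L))
                    (ℕ.*-distribʳ-+ (f (old L)) (weight T L) (𝟙 (K ≟ᶜ L)))

  -- By `∑-weight-insert` at the constant function 1, an insertion adds 1 for the chosen clique and
  -- 1 for each of the k new ones.
  ∑-weight : ∀ (T : Tree k n) → ∑ᴱ (cliqueEnum k n) (weight T) ≡ suc (suc k * n)
  ∑-weight {k} root = cong suc (sym (ℕ.*-zeroʳ k))
  ∑-weight {k} (insert {n} T K p) = begin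
    ∑ᴱ (cliqueEnum k (suc n)) (weight T⁺)
      ≡⟨ ∑ᴱ-cong (cliqueEnum k (suc n)) (λ L → sym (ℕ.*-identityʳ (weight T⁺ L))) ⟩
    (∑[ L ∈ cliqueEnum k (suc n) ] weight T⁺ L * 1)
      ≡⟨ ∑-weight-insert T K p (λ _ → 1) ⟩
    (∑[ L ∈ cliqueEnum k n ] weight T L * 1) + 1 + (∑[ i ∈ finEnum k ] 1)
      ≡⟨ cong₂ (λ a b → a + 1 + b)
           (trans (∑ᴱ-cong (cliqueEnum k n) λ L → ℕ.*-identityʳ (weight T L)) (∑-weight T))
           (∑-Fin-const k 1) ⟩
    suc (suc k * n) + 1 + k * 1
      ≡⟨ arith k n ⟩
    suc (suc k * suc n) ∎
    where
    T⁺ = insert T K p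
    arith : ∀ k n → suc (suc k * n) + 1 + k * 1 ≡ suc (suc k * suc n)
    arith = solve-∀

  -- Descendants under insertion.

  Touches : Tree k n → Vertex k n → Clique k n → Set
  Touches T u K = VecAny.Any (Descendant T u) (vertices T K)

  touches? : ∀ (T : Tree k n) u K → Dec (Touches T u K)
  touches? T u K = VecAny.any? (descendant? T u) (vertices T K)

  Any-[]≔⁻ : ∀ {P : Pred A 0ℓ} {m} (xs : Vec A m) i {y} →
             VecAny.Any P (xs [ i ]≔ y) → P y ⊎ VecAny.Any P xs
  Any-[]≔⁻ (x Vec.∷ xs) zero    (VecAny.here p)  = inj₁ p
  Any-[]≔⁻ (x Vec.∷ xs) zero    (VecAny.there a) = inj₂ (VecAny.there a)
  Any-[]≔⁻ (x Vec.∷ xs) (suc i) (VecAny.here p)  = inj₂ (VecAny.here p)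
  Any-[]≔⁻ (x Vec.∷ xs) (suc i) (VecAny.there a) with Any-[]≔⁻ xs i a
  ... | inj₁ p = inj₁ p
  ... | inj₂ b = inj₂ (VecAny.there b)

  module _ (T : Tree k n) (K : Clique k n) (p : Fin (weight T K)) where

    private
      T⁺ = insert T K p

    touches-map-older⁺ : ∀ {u} L → Touches T u L →
      VecAny.Any (Descendant T⁺ (older u)) (Vec.map older (vertices T L))
    touches-map-older⁺ L a = VecAny.map⁺ (VecAny.map (older⁺ {p = p}) a)

    touches-map-older⁻ : ∀ {u} L →
      VecAny.Any (Descendant T⁺ (older u)) (Vec.map older (vertices T L)) → Touches T u L
    touches-map-older⁻ L a = VecAny.map (λ {w} → older⁻ w refl) (VecAny.map⁻ a)

    newest-∉ : ∀ L → ¬ Touches T⁺ (inj₂ zero) (old L)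
    newest-∉ L a with (w , _ , d) ← find (VecAny.map⁻ {xs = vertices T L} a) =
      zero-not-above w refl d

    newest∈new : ∀ i → inj₂ zero ∈ᵛ vertices T⁺ (new i)
    newest∈new i = subst (_∈ᵛ vertices T⁺ (new i))
      (Vec.lookup∘update i (Vec.map older (vertices T K)) (inj₂ zero))
      (Vec.∈-lookup i (vertices T⁺ (new i)))

    descendant-newest⁺ : ∀ {u} → Touches T u K → Descendant T⁺ (older u) (inj₂ zero)
    descendant-newest⁺ a with (v , v∈ , d) ← find (touches-map-older⁺ K a) = child v∈ d

    descendant-newest⁻ : ∀ {u} → Descendant T⁺ (inj₂ (suc u)) (inj₂ zero) → Touches T (inj₂ u) K
    descendant-newest⁻ (child v∈ d) = touches-map-older⁻ K (loseᵛ v∈ d)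

    -- All vertices of `new i` other than the newest node come from `K`. If the newest node itself
    -- descends from `u`, it does so through a parent, and its parents are again the vertices of
    -- `K`.
    touches-new⁻ : ∀ {u} i → Touches T⁺ (inj₂ (suc u)) (new i) → Touches T (inj₂ u) K
    touches-new⁻ i a with Any-[]≔⁻ (Vec.map older (vertices T K)) i a
    ... | inj₁ d = descendant-newest⁻ d
    ... | inj₂ b = touches-map-older⁻ K b

    descendants-newest : descendants (T⁺ , zero) ≡ 1
    descendants-newest = begin
      count (vertexEnum k (suc n)) (descendant? T⁺ (inj₂ zero))
        ≡⟨ count-∑ (vertexEnum k (suc n)) (descendant? T⁺ (inj₂ zero)) ⟩
      (∑[ w ∈ vertexEnum k (suc n) ] 𝟙 (descendant? T⁺ (inj₂ zero) w))
        ≡⟨ ∑-vertices k n _ ⟩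
      1 + (∑[ w ∈ vertexEnum k n ] 𝟙 (descendant? T⁺ (inj₂ zero) (older w)))
        ≡⟨ cong suc (∑ᴱ-cong (vertexEnum k n) λ w → 𝟙-no (descendant? T⁺ (inj₂ zero) (older w)) (zero-not-above w refl)) ⟩
      1 + (∑[ w ∈ vertexEnum k n ] 0)
        ≡⟨ cong suc (trans (∑ᴸ-const (elements (vertexEnum k n)) 0) (ℕ.*-zeroʳ (size (vertexEnum k n)))) ⟩
      1 ∎

    -- Descent between older vertices is unaffected, and the newest node falls below `u` exactly
    -- when some vertex of `K` is a descendant of `u`.
    descendants-older : ∀ u → descendants (T⁺ , suc u) ≡ 𝟙 (touches? T (inj₂ u) K) + descendants (T , u)
    descendants-older u = begin
      count (vertexEnum k (suc n)) (descendant? T⁺ (inj₂ (suc u)))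
        ≡⟨ count-∑ (vertexEnum k (suc n)) (descendant? T⁺ (inj₂ (suc u))) ⟩
      (∑[ w ∈ vertexEnum k (suc n) ] 𝟙 (descendant? T⁺ (inj₂ (suc u)) w))
        ≡⟨ ∑-vertices k n _ ⟩
      𝟙 (descendant? T⁺ (inj₂ (suc u)) (inj₂ zero)) + (∑[ w ∈ vertexEnum k n ] 𝟙 (descendant? T⁺ (inj₂ (suc u)) (older w)))
        ≡⟨ cong₂ _+_
             (𝟙-cong (descendant? T⁺ (inj₂ (suc u)) (inj₂ zero)) (touches? T (inj₂ u) K)
               descendant-newest⁻ descendant-newest⁺)
             (∑ᴱ-cong (vertexEnum k n) λ w →
               𝟙-cong (descendant? T⁺ (inj₂ (suc u)) (older w)) (descendant? T (inj₂ u) w) (older⁻ w refl) older⁺) ⟩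
      𝟙 (touches? T (inj₂ u) K) + (∑[ w ∈ vertexEnum k n ] 𝟙 (descendant? T (inj₂ u) w))
        ≡⟨ cong (𝟙 (touches? T (inj₂ u) K) +_) (count-∑ (vertexEnum k n) (descendant? T (inj₂ u))) ⟨
      𝟙 (touches? T (inj₂ u) K) + descendants (T , u) ∎

  -- The k cliques created with u all contain u, and each further descendant
  -- of u raises the weight of the cliques touching the subtree by k + 1.
  ∑-touching : ∀ (T : Tree k n) u →
    suc (∑[ L ∈ cliqueEnum k n ] weight T L * 𝟙 (touches? T (inj₂ u) L)) ≡ suc k * descendants (T , u)
  ∑-touching {k} (insert {n} T K p) zero = begin
    suc (∑[ L ∈ cliqueEnum k (suc n) ] weight T⁺ L * t⁺ L)
      ≡⟨ cong suc (∑-weight-insert T K p t⁺) ⟩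
    suc ((∑[ L ∈ cliqueEnum k n ] weight T L * t⁺ (old L)) + t⁺ (old K) + (∑[ i ∈ finEnum k ] t⁺ (new i)))
      ≡⟨ cong suc (cong₂ _+_ (cong₂ _+_
           (trans (∑ᴱ-cong (cliqueEnum k n) λ L → trans (cong (weight T L *_) (not-old L)) (ℕ.*-zeroʳ (weight T L)))
                  (trans (∑ᴸ-const (elements (cliqueEnum k n)) 0) (ℕ.*-zeroʳ (size (cliqueEnum k n)))))
           (not-old K))
           (trans (∑ᴱ-cong (finEnum k) λ i → 𝟙-yes (touches? T⁺ (inj₂ zero) (new i)) (loseᵛ (newest∈new T K p i) self))
                  (∑-Fin-const k 1))) ⟩
    suc (0 + 0 + k * 1)
      ≡⟨⟩
    suc k * 1
      ≡⟨ cong (suc k *_) (descendants-newest T K p) ⟨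
    suc k * descendants (T⁺ , zero) ∎
    where
    T⁺ = insert T K p
    t⁺ : Clique k (suc n) → ℕ
    t⁺ L = 𝟙 (touches? T⁺ (inj₂ zero) L)
    not-old : ∀ L → t⁺ (old L) ≡ 0
    not-old L = 𝟙-no (touches? T⁺ (inj₂ zero) (old L)) (newest-∉ T K p L)
  ∑-touching {k} (insert {n} T K p) (suc u) = begin
    suc (∑[ L ∈ cliqueEnum k (suc n) ] weight T⁺ L * t⁺ L)
      ≡⟨ cong suc (∑-weight-insert T K p t⁺) ⟩
    suc ((∑[ L ∈ cliqueEnum k n ] weight T L * t⁺ (old L)) + t⁺ (old K) + (∑[ i ∈ finEnum k ] t⁺ (new i)))
      ≡⟨ cong suc (cong₂ _+_ (cong₂ _+_
           (∑ᴱ-cong (cliqueEnum k n) λ L → cong (weight T L *_) (t⁺-old L))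
           (t⁺-old K))
           (trans (∑ᴱ-cong (finEnum k) t⁺-new) (∑-Fin-const k (t K)))) ⟩
    suc (∑[ L ∈ cliqueEnum k n ] weight T L * t L) + t K + k * t K
      ≡⟨ cong (λ s → s + t K + k * t K) (∑-touching T u) ⟩
    suc k * descendants (T , u) + t K + k * t K
      ≡⟨ arith k (descendants (T , u)) (t K) ⟩
    suc k * (t K + descendants (T , u))
      ≡⟨ cong (suc k *_) (descendants-older T K p u) ⟨
    suc k * descendants (T⁺ , suc u) ∎
    where
    T⁺ = insert T K p
    t⁺ : Clique k (suc n) → ℕ
    t⁺ L = 𝟙 (touches? T⁺ (inj₂ (suc u)) L)
    t : Clique k n → ℕ
    t L = 𝟙 (touches? T (inj₂ u) L)
    t⁺-old : ∀ L → t⁺ (old L) ≡ t L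
    t⁺-old L = 𝟙-cong (touches? T⁺ (inj₂ (suc u)) (old L)) (touches? T (inj₂ u) L)
      (touches-map-older⁻ T K p L) (touches-map-older⁺ T K p L)
    -- For the converse, the vertex that `new i` drops may be the only descendant of u in `K`; the
    -- newest node, present in every new clique, serves as the witness instead.
    t⁺-new : ∀ i → t⁺ (new i) ≡ t K
    t⁺-new i = 𝟙-cong (touches? T⁺ (inj₂ (suc u)) (new i)) (touches? T (inj₂ u) K)
      (touches-new⁻ T K p i) λ a → loseᵛ (newest∈new T K p i) (descendant-newest⁺ T K p a)
    arith : ∀ k d t → suc k * d + t + k * t ≡ suc k * (t + d)
    arith = solve-∀

  -- The recurrence for pairs of a tree and a node with m descendants.

  subtrees : ∀ k n m → ℕ
  subtrees k n m = count (ΩEnum k n) (λ ω → descendants ω ℕ.≟ m)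

  subtrees-∑ : ∀ k n m → subtrees k n m ≡
    ∑[ T ∈ treeEnum k n ] ∑[ u ∈ finEnum n ] 𝟙 (descendants (T , u) ℕ.≟ m)
  subtrees-∑ k n m = trans (count-∑ (ΩEnum k n) λ ω → descendants ω ℕ.≟ m) (∑-Ω k n _)

  size-trees-suc : ∀ k n → size (treeEnum k (suc n)) ≡ size (treeEnum k n) * suc (suc k * n)
  size-trees-suc k n = begin
    size (treeEnum k (suc n))
      ≡⟨ size-∑ (treeEnum k (suc n)) ⟩
    (∑[ T ∈ treeEnum k (suc n) ] 1)
      ≡⟨ ∑-trees k n _ ⟩
    (∑[ T ∈ treeEnum k n ] ∑[ K ∈ cliqueEnum k n ] ∑[ p ∈ finEnum (weight T K) ] 1)
      ≡⟨ ∑ᴱ-cong (treeEnum k n) (λ T → trans (∑ᴱ-cong (cliqueEnum k n) λ K →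
           trans (∑-Fin-const (weight T K) 1) (ℕ.*-identityʳ (weight T K))) (∑-weight T)) ⟩
    (∑[ T ∈ treeEnum k n ] suc (suc k * n))
      ≡⟨ ∑ᴸ-const (elements (treeEnum k n)) _ ⟩
    size (treeEnum k n) * suc (suc k * n) ∎

  size-Ω : ∀ k n → size (ΩEnum k n) ≡ size (treeEnum k n) * n
  size-Ω k n = begin
    size (ΩEnum k n)
      ≡⟨ size-∑ (ΩEnum k n) ⟩
    (∑[ ω ∈ ΩEnum k n ] 1)
      ≡⟨ ∑-Ω k n _ ⟩
    (∑[ T ∈ treeEnum k n ] ∑[ u ∈ finEnum n ] 1)
      ≡⟨ ∑ᴱ-cong (treeEnum k n) (λ _ → trans (∑-Fin-const n 1) (ℕ.*-identityʳ n)) ⟩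
    (∑[ T ∈ treeEnum k n ] n)
      ≡⟨ ∑ᴸ-const (elements (treeEnum k n)) _ ⟩
    size (treeEnum k n) * n ∎

  -- The left side of `∑-touching` is a successor, whereas zero descendants would make its right
  -- side 0.
  descendants≢0 : ∀ (T : Tree k n) u → ¬ descendants (T , u) ≡ 0
  descendants≢0 {k} T u eq with () ← trans (∑-touching T u) (trans (cong (suc k *_) eq) (ℕ.*-zeroʳ k))

  subtrees-0 : ∀ k n → subtrees k n 0 ≡ 0
  subtrees-0 k n = begin
    subtrees k n 0
      ≡⟨ subtrees-∑ k n 0 ⟩
    (∑[ T ∈ treeEnum k n ] ∑[ u ∈ finEnum n ] 𝟙 (descendants (T , u) ℕ.≟ 0))
      ≡⟨ ∑ᴱ-cong (treeEnum k n) (λ T → trans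
           (∑ᴱ-cong (finEnum n) λ u → 𝟙-no (descendants (T , u) ℕ.≟ 0) (descendants≢0 T u))
           (trans (∑-Fin-const n 0) (ℕ.*-zeroʳ n))) ⟩
    (∑[ T ∈ treeEnum k n ] 0)
      ≡⟨ trans (∑ᴸ-const (elements (treeEnum k n)) 0) (ℕ.*-zeroʳ (size (treeEnum k n))) ⟩
    0 ∎

  -- Under the indicator of `d ≡ m`, the varying `d` may be traded for the constant `m`. This turns
  -- tree-dependent weights into coefficients of the recurrence.
  𝟙-≡-* : ∀ {d m} (d≟m : Dec (d ≡ m)) → d * 𝟙 d≟m ≡ m * 𝟙 d≟m
  𝟙-≡-* (yes refl)        = refl
  𝟙-≡-* {d} {m} (no d≢m) = trans (ℕ.*-zeroʳ d) (sym (ℕ.*-zeroʳ m))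

  𝟙-≟-suc : ∀ d m → 𝟙 (suc d ℕ.≟ suc m) ≡ 𝟙 (d ℕ.≟ m)
  𝟙-≟-suc d m = 𝟙-cong (suc d ℕ.≟ suc m) (d ℕ.≟ m) ℕ.suc-injective (cong suc)

  -- Let W be the total weight and a = (k+1)d - 1 the weight touching the d descendants of `u`. A
  -- choice of `K` leads to m+1 descendants with weight W - a if d = m+1, and with weight a if d =
  -- m. Moving the negative terms to the left gives this form over ℕ.
  ∑-insert-older : ∀ (T : Tree k n) u m →
    (∑[ K ∈ cliqueEnum k n ] weight T K * 𝟙 (𝟙 (touches? T (inj₂ u) K) + descendants (T , u) ℕ.≟ suc m))
      + suc k * suc m * 𝟙 (descendants (T , u) ℕ.≟ suc m) + 𝟙 (descendants (T , u) ℕ.≟ m) ≡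
    (suc k * n + 2) * 𝟙 (descendants (T , u) ℕ.≟ suc m) + suc k * m * 𝟙 (descendants (T , u) ℕ.≟ m)
  ∑-insert-older {k} {n} T u m = begin
    x + suc k * suc m * e′ + e
      -- `∑-touching` speaks of d, so m+1 is replaced by d under the indicator before it applies,
      -- and d by m afterwards.
      ≡⟨ cong (λ z → x + z + e) (trans (ℕ.*-assoc (suc k) (suc m) e′) (trans (cong (suc k *_) (sym (𝟙-≡-* (d ℕ.≟ (suc m))))) (sym (ℕ.*-assoc (suc k) d e′)))) ⟩
    x + suc k * d * e′ + e
      ≡⟨ cong (λ z → x + z * e′ + e) (∑-touching T u) ⟨
    x + suc a * e′ + e
      ≡⟨ arith₁ x a e′ e ⟩
    x + a * e′ + (e′ + e)
      ≡⟨ cong (_+ (e′ + e)) exchange ⟩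
    suc (suc k * n) * e′ + a * e + (e′ + e)
      ≡⟨ arith₂ (suc k * n) a e′ e ⟩
    (suc k * n + 2) * e′ + suc a * e
      ≡⟨ cong (λ z → (suc k * n + 2) * e′ + z * e) (∑-touching T u) ⟩
    (suc k * n + 2) * e′ + suc k * d * e
      ≡⟨ cong ((suc k * n + 2) * e′ +_) (trans (ℕ.*-assoc (suc k) d e) (trans (cong (suc k *_) (𝟙-≡-* (d ℕ.≟ m))) (sym (ℕ.*-assoc (suc k) m e)))) ⟩
    (suc k * n + 2) * e′ + suc k * m * e ∎
    where
    d e e′ a x : ℕ
    t : Clique k n → ℕ
    t K = 𝟙 (touches? T (inj₂ u) K)
    d  = descendants (T , u)
    e  = 𝟙 (d ℕ.≟ m)
    e′ = 𝟙 (d ℕ.≟ suc m)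
    a  = ∑[ K ∈ cliqueEnum k n ] weight T K * t K
    x  = ∑[ K ∈ cliqueEnum k n ] weight T K * 𝟙 (t K + d ℕ.≟ suc m)
    -- For an untouched clique both extra terms vanish. For a touched one the count becomes d+1, so
    -- that the test against m+1 is the test of d against m.
    pointwise : ∀ K → weight T K * 𝟙 (t K + d ℕ.≟ suc m) + weight T K * t K * e′ ≡ weight T K * e′ + weight T K * t K * e
    pointwise K with touches? T (inj₂ u) K
    ... | no _  = absent (weight T K) e e′
      where
      absent : ∀ w e e′ → w * e′ + w * 0 * e′ ≡ w * e′ + w * 0 * e
      absent = solve-∀
    ... | yes _ = trans (cong (λ x → weight T K * x + weight T K * 1 * e′) (𝟙-≟-suc d m)) (present (weight T K) e e′)
      where
      present : ∀ w e e′ → w * e + w * 1 * e′ ≡ w * e′ + w * 1 * e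
      present = solve-∀
    cliques = elements (cliqueEnum k n)
    exchange : x + a * e′ ≡ suc (suc k * n) * e′ + a * e
    exchange = begin
      x + a * e′
        ≡⟨ cong (x +_) (∑ᴸ-* cliques (λ K → weight T K * t K) e′) ⟨
      x + (∑[ K ∈ cliqueEnum k n ] weight T K * t K * e′)
        ≡⟨ ∑ᴸ-+ cliques _ _ ⟨
      (∑[ K ∈ cliqueEnum k n ] weight T K * 𝟙 (t K + d ℕ.≟ suc m) + weight T K * t K * e′)
        ≡⟨ ∑ᴱ-cong (cliqueEnum k n) pointwise ⟩
      (∑[ K ∈ cliqueEnum k n ] weight T K * e′ + weight T K * t K * e)
        ≡⟨ ∑ᴸ-+ cliques _ _ ⟩
      (∑[ K ∈ cliqueEnum k n ] weight T K * e′) + (∑[ K ∈ cliqueEnum k n ] weight T K * t K * e)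
        ≡⟨ cong₂ _+_ (∑ᴸ-* cliques (weight T) e′) (∑ᴸ-* cliques (λ K → weight T K * t K) e) ⟩
      ∑ᴱ (cliqueEnum k n) (weight T) * e′ + a * e
        ≡⟨ cong (λ z → z * e′ + a * e) (∑-weight T) ⟩
      suc (suc k * n) * e′ + a * e ∎
    arith₁ : ∀ x a e′ e → x + suc a * e′ + e ≡ x + a * e′ + (e′ + e)
    arith₁ = solve-∀
    arith₂ : ∀ w a e′ e → suc w * e′ + a * e + (e′ + e) ≡ (w + 2) * e′ + suc a * e
    arith₂ = solve-∀

  -- `∑-insert-older` summed over all trees and nodes covers the older nodes; each tree of size n+1
  -- adds its newest node, whose only descendant is itself.
  subtrees-suc : ∀ k n m →
    subtrees k (suc n) (suc m) + suc k * suc m * subtrees k n (suc m) + subtrees k n m ≡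
    size (treeEnum k (suc n)) * 𝟙 (1 ℕ.≟ suc m) + ((suc k * n + 2) * subtrees k n (suc m) + suc k * m * subtrees k n m)
  subtrees-suc k n m = begin
    subtrees k (suc n) (suc m) + cm * subtrees k n (suc m) + subtrees k n m
      ≡⟨ cong₂ _+_ (cong₂ _+_ expand (scale cm (suc m))) (subtrees-∑ k n m) ⟩
    N + Y + S′ + S
      ≡⟨ trans (cong (_+ S) (ℕ.+-assoc N Y S′)) (ℕ.+-assoc N (Y + S′) S) ⟩
    N + (Y + S′ + S)
      ≡⟨ cong (N +_) (trans (∑∑-+ (λ T u → y T u + cm * e′ T u) e) (cong (_+ S) (∑∑-+ y λ T u → cm * e′ T u))) ⟨
    N + (∑[ T ∈ treeEnum k n ] ∑[ u ∈ finEnum n ] y T u + cm * e′ T u + e T u)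
      ≡⟨ cong (N +_) (∑ᴱ-cong (treeEnum k n) λ T → ∑ᴱ-cong (finEnum n) λ u → ∑-insert-older T u m) ⟩
    N + (∑[ T ∈ treeEnum k n ] ∑[ u ∈ finEnum n ] (suc k * n + 2) * e′ T u + suc k * m * e T u)
      ≡⟨ cong (N +_) (∑∑-+ _ _) ⟩
    N + ((∑[ T ∈ treeEnum k n ] ∑[ u ∈ finEnum n ] (suc k * n + 2) * e′ T u) + (∑[ T ∈ treeEnum k n ] ∑[ u ∈ finEnum n ] suc k * m * e T u))
      ≡⟨ cong (N +_) (cong₂ _+_ (scale (suc k * n + 2) (suc m)) (scale (suc k * m) m)) ⟨
    N + ((suc k * n + 2) * subtrees k n (suc m) + suc k * m * subtrees k n m) ∎
    where
    cm N Y S S′ : ℕ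
    y e e′ : Tree k n → Fin n → ℕ
    cm = suc k * suc m
    e  T u = 𝟙 (descendants (T , u) ℕ.≟ m)
    e′ T u = 𝟙 (descendants (T , u) ℕ.≟ suc m)
    y  T u = ∑[ K ∈ cliqueEnum k n ] weight T K * 𝟙 (𝟙 (touches? T (inj₂ u) K) + descendants (T , u) ℕ.≟ suc m)
    N = size (treeEnum k (suc n)) * 𝟙 (1 ℕ.≟ suc m)
    Y = ∑[ T ∈ treeEnum k n ] ∑[ u ∈ finEnum n ] y T u
    S = ∑[ T ∈ treeEnum k n ] ∑[ u ∈ finEnum n ] e T u
    S′ = ∑[ T ∈ treeEnum k n ] ∑[ u ∈ finEnum n ] cm * e′ T u

    ∑∑-+ : ∀ (f g : Tree k n → Fin n → ℕ) →
      (∑[ T ∈ treeEnum k n ] ∑[ u ∈ finEnum n ] f T u + g T u) ≡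
      (∑[ T ∈ treeEnum k n ] ∑[ u ∈ finEnum n ] f T u) + (∑[ T ∈ treeEnum k n ] ∑[ u ∈ finEnum n ] g T u)
    ∑∑-+ f g = trans (∑ᴱ-cong (treeEnum k n) λ T → ∑ᴸ-+ (allFin n) (f T) (g T)) (∑ᴸ-+ (elements (treeEnum k n)) _ _)

    scale : ∀ c m → c * subtrees k n m ≡
      ∑[ T ∈ treeEnum k n ] ∑[ u ∈ finEnum n ] c * 𝟙 (descendants (T , u) ℕ.≟ m)
    scale c m = begin
      c * subtrees k n m
        ≡⟨ trans (ℕ.*-comm c _) (cong (_* c) (subtrees-∑ k n m)) ⟩
      (∑[ T ∈ treeEnum k n ] ∑[ u ∈ finEnum n ] 𝟙 (descendants (T , u) ℕ.≟ m)) * c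
        ≡⟨ ∑ᴸ-* (elements (treeEnum k n)) _ c ⟨
      (∑[ T ∈ treeEnum k n ] (∑[ u ∈ finEnum n ] 𝟙 (descendants (T , u) ℕ.≟ m)) * c)
        ≡⟨ ∑ᴱ-cong (treeEnum k n) (λ T → trans (sym (∑ᴸ-* (allFin n) _ c)) (∑ᴱ-cong (finEnum n) λ u → ℕ.*-comm _ c)) ⟩
      (∑[ T ∈ treeEnum k n ] ∑[ u ∈ finEnum n ] c * 𝟙 (descendants (T , u) ℕ.≟ m)) ∎

    inserted : ∀ T K (p : Fin (weight T K)) →
      (∑[ u ∈ finEnum (suc n) ] 𝟙 (descendants (insert T K p , u) ℕ.≟ suc m)) ≡
      𝟙 (1 ℕ.≟ suc m) + (∑[ u ∈ finEnum n ] 𝟙 (𝟙 (touches? T (inj₂ u) K) + descendants (T , u) ℕ.≟ suc m))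
    inserted T K p = trans (∑-Fin-suc n λ u → 𝟙 (descendants (insert T K p , u) ℕ.≟ suc m))
      (cong₂ _+_ (cong (λ d → 𝟙 (d ℕ.≟ suc m)) (descendants-newest T K p))
        (∑ᴱ-cong (finEnum n) λ u → cong (λ d → 𝟙 (d ℕ.≟ suc m)) (descendants-older T K p u)))

    perTree : ∀ T →
      (∑[ K ∈ cliqueEnum k n ] ∑[ p ∈ finEnum (weight T K) ] ∑[ u ∈ finEnum (suc n) ] 𝟙 (descendants (insert T K p , u) ℕ.≟ suc m))
      ≡ suc (suc k * n) * 𝟙 (1 ℕ.≟ suc m) + (∑[ u ∈ finEnum n ] y T u)
    perTree T = begin
      (∑[ K ∈ cliqueEnum k n ] ∑[ p ∈ finEnum (weight T K) ] ∑[ u ∈ finEnum (suc n) ] 𝟙 (descendants (insert T K p , u) ℕ.≟ suc m))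
        ≡⟨ ∑ᴱ-cong (cliqueEnum k n) (λ K → trans (∑ᴱ-cong (finEnum (weight T K)) (inserted T K))
             (trans (∑-Fin-const (weight T K) _) (ℕ.*-distribˡ-+ (weight T K) (𝟙 (1 ℕ.≟ suc m)) (∑ᴱ (finEnum n) (z K))))) ⟩
      (∑[ K ∈ cliqueEnum k n ] weight T K * 𝟙 (1 ℕ.≟ suc m) + weight T K * (∑[ u ∈ finEnum n ] z K u))
        ≡⟨ ∑ᴸ-+ cliques _ _ ⟩
      (∑[ K ∈ cliqueEnum k n ] weight T K * 𝟙 (1 ℕ.≟ suc m)) + (∑[ K ∈ cliqueEnum k n ] weight T K * (∑[ u ∈ finEnum n ] z K u))
        ≡⟨ cong₂ _+_
             (trans (∑ᴸ-* cliques (weight T) (𝟙 (1 ℕ.≟ suc m))) (cong (_* 𝟙 (1 ℕ.≟ suc m)) (∑-weight T)))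
             (trans (∑ᴱ-cong (cliqueEnum k n) λ K →
                 trans (ℕ.*-comm (weight T K) _) (trans (sym (∑ᴸ-* (allFin n) (z K) (weight T K))) (∑ᴱ-cong (finEnum n) λ u → ℕ.*-comm _ (weight T K))))
               (∑ᴸ-swap cliques (allFin n) λ K u → weight T K * z K u)) ⟩
      suc (suc k * n) * 𝟙 (1 ℕ.≟ suc m) + (∑[ u ∈ finEnum n ] y T u) ∎
      where
      cliques = elements (cliqueEnum k n)
      z : Clique k n → Fin n → ℕ
      z K u = 𝟙 (𝟙 (touches? T (inj₂ u) K) + descendants (T , u) ℕ.≟ suc m)

    expand : subtrees k (suc n) (suc m) ≡ N + Y
    expand = begin
      subtrees k (suc n) (suc m)
        ≡⟨ subtrees-∑ k (suc n) (suc m) ⟩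
      (∑[ T ∈ treeEnum k (suc n) ] ∑[ u ∈ finEnum (suc n) ] 𝟙 (descendants (T , u) ℕ.≟ suc m))
        ≡⟨ ∑-trees k n _ ⟩
      (∑[ T ∈ treeEnum k n ] ∑[ K ∈ cliqueEnum k n ] ∑[ p ∈ finEnum (weight T K) ] ∑[ u ∈ finEnum (suc n) ] 𝟙 (descendants (insert T K p , u) ℕ.≟ suc m))
        ≡⟨ ∑ᴱ-cong (treeEnum k n) perTree ⟩
      (∑[ T ∈ treeEnum k n ] suc (suc k * n) * 𝟙 (1 ℕ.≟ suc m) + (∑[ u ∈ finEnum n ] y T u))
        ≡⟨ ∑ᴸ-+ (elements (treeEnum k n)) _ _ ⟩
      (∑[ T ∈ treeEnum k n ] suc (suc k * n) * 𝟙 (1 ℕ.≟ suc m)) + Y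
        ≡⟨ cong (_+ Y) (trans (∑ᴸ-const (elements (treeEnum k n)) _)
             (trans (sym (ℕ.*-assoc (size (treeEnum k n)) (suc (suc k * n)) (𝟙 (1 ℕ.≟ suc m)))) (cong (_* 𝟙 (1 ℕ.≟ suc m)) (sym (size-trees-suc k n))))) ⟩
      N + Y ∎

open Counting using (𝟙; subtrees; subtrees-suc; subtrees-0; size-Ω; size-trees-suc)
open import Data.Integer.Base as ℤ using (ℤ; +_; -[1+_]; -1ℤ; _^_)
import Data.Integer.Properties as ℤ
open import Data.Rational.Base
  using (ℚ; 0ℚ; 1ℚ; _/_; _+_; _*_; _-_; -_; 1/_; _÷_; _≤_; _<_; ∣_∣; floor; mkℚ;
         Positive; positive; nonNegative)
  renaming (NonZero to NonZeroℚ)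
import Data.Rational.Base as ℚ
import Data.Rational.Properties as ℚ
import Data.Rational.Unnormalised.Base as ℚᵘ
import Data.Rational.Unnormalised.Properties as ℚᵘ
open import Relation.Nullary.Decidable using (dec⇒maybe)
open import Tactic.RingSolver using (solve-∀)
open import Tactic.RingSolver.Core.AlmostCommutativeRing using (AlmostCommutativeRing; fromCommutativeRing)

-- Rational arithmetic and binomial coefficients with rational upper argument.

module ClosedForm where

  open ≡-Reasoning

  ℚ-ring : AlmostCommutativeRing 0ℓ 0ℓ
  ℚ-ring = fromCommutativeRing ℚ.+-*-commutativeRing λ p → dec⇒maybe (0ℚ ℚ.≟ p)

  *-1/-cancel : ∀ p r .{{_ : NonZeroℚ r}} → p * r * 1/ r ≡ p
  *-1/-cancel p r = trans (ℚ.*-assoc p r (1/ r)) (trans (cong (p *_) (ℚ.*-inverseʳ r)) (ℚ.*-identityʳ p))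

  *-cancelʳ : ∀ {p q} r .{{_ : NonZeroℚ r}} → p * r ≡ q * r → p ≡ q
  *-cancelʳ {p} {q} r pr≡qr =
    trans (sym (*-1/-cancel p r)) (trans (cong (_* 1/ r) pr≡qr) (*-1/-cancel q r))

  fromℕ≢0 : ∀ n .{{_ : NonZero n}} → NonZeroℚ (fromℕ n)
  fromℕ≢0 n = ℚ.pos⇒nonZero (fromℕ n) {{fromℕ-pos n}}

  +≡⇒≡- : ∀ {a b c} → a + b ≡ c → a ≡ c - b
  +≡⇒≡- {a} {b} a+b≡c = trans (lemma a b) (cong (_- b) a+b≡c)
    where
    lemma : ∀ a b → a ≡ a + b - b
    lemma = solve-∀ ℚ-ring

  fromℕ-+ : ∀ m n → fromℕ (m ℕ.+ n) ≡ fromℕ m + fromℕ n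
  fromℕ-+ zero    n = sym (ℚ.+-identityˡ (fromℕ n))
  fromℕ-+ (suc m) n = begin
    fromℕ (suc (m ℕ.+ n))      ≡⟨ fromℕ-suc (m ℕ.+ n) ⟩
    fromℕ (m ℕ.+ n) + 1ℚ       ≡⟨ cong (_+ 1ℚ) (fromℕ-+ m n) ⟩
    fromℕ m + fromℕ n + 1ℚ     ≡⟨ lemma (fromℕ m) (fromℕ n) ⟩
    fromℕ m + 1ℚ + fromℕ n     ≡⟨ cong (_+ fromℕ n) (fromℕ-suc m) ⟨
    fromℕ (suc m) + fromℕ n    ∎
    where
    lemma : ∀ m n → m + n + 1ℚ ≡ m + 1ℚ + n
    lemma = solve-∀ ℚ-ring

  fromℕ-* : ∀ m n → fromℕ (m ℕ.* n) ≡ fromℕ m * fromℕ n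
  fromℕ-* zero    n = sym (ℚ.*-zeroˡ (fromℕ n))
  fromℕ-* (suc m) n = begin
    fromℕ (n ℕ.+ m ℕ.* n)        ≡⟨ fromℕ-+ n (m ℕ.* n) ⟩
    fromℕ n + fromℕ (m ℕ.* n)    ≡⟨ cong (λ x → fromℕ n + x) (fromℕ-* m n) ⟩
    fromℕ n + fromℕ m * fromℕ n  ≡⟨ lemma (fromℕ m) (fromℕ n) ⟩
    (fromℕ m + 1ℚ) * fromℕ n     ≡⟨ cong (_* fromℕ n) (fromℕ-suc m) ⟨
    fromℕ (suc m) * fromℕ n      ∎
    where
    lemma : ∀ m n → n + m * n ≡ (m + 1ℚ) * n
    lemma = solve-∀ ℚ-ring

  -- `i / n` is stored in lowest terms, so the identity is checked on unnormalised representatives,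
  -- where it is a cross-multiplication.
  /-*-cancel : ∀ i n .{{_ : NonZero n}} → (i / n) * fromℕ n ≡ i / 1
  /-*-cancel i n@(suc n-1) = ℚ.toℚᵘ-injective (begin′
    ℚ.toℚᵘ ((i / n) * fromℕ n)
      ≈⟨ ℚ.toℚᵘ-homo-* (i / n) (fromℕ n) ⟩
    ℚ.toℚᵘ (i / n) ℚᵘ.* ℚ.toℚᵘ (fromℕ n)
      ≈⟨ ℚᵘ.*-cong (ℚ.toℚᵘ-fromℚᵘ (ℚᵘ.mkℚᵘ i n-1)) (ℚ.toℚᵘ-fromℚᵘ (ℚᵘ.mkℚᵘ (+ n) 0)) ⟩
    ℚᵘ.mkℚᵘ i n-1 ℚᵘ.* ℚᵘ.mkℚᵘ (+ n) 0
      ≈⟨ ℚᵘ.*≡* (trans (ℤ.*-identityʳ _) (cong (λ d → i ℤ.* + d) (sym (ℕ.*-identityʳ n)))) ⟩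
    ℚᵘ.mkℚᵘ i 0
      ≈⟨ ℚ.toℚᵘ-fromℚᵘ (ℚᵘ.mkℚᵘ i 0) ⟨
    ℚ.toℚᵘ (i / 1) ∎′)
    where open ℚᵘ.≃-Reasoning renaming (begin_ to begin′_; _∎ to _∎′)

  /1-neg : ∀ i → (ℤ.- i) / 1 ≡ - (i / 1)
  /1-neg i = ℚ.toℚᵘ-injective (begin′
    ℚ.toℚᵘ ((ℤ.- i) / 1)      ≈⟨ ℚ.toℚᵘ-fromℚᵘ (ℚᵘ.mkℚᵘ (ℤ.- i) 0) ⟩
    ℚᵘ.- ℚᵘ.mkℚᵘ i 0          ≈⟨ ℚᵘ.-‿cong (ℚ.toℚᵘ-fromℚᵘ (ℚᵘ.mkℚᵘ i 0)) ⟨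
    ℚᵘ.- ℚ.toℚᵘ (i / 1)       ≈⟨ ℚ.toℚᵘ-homo‿- (i / 1) ⟨
    ℚ.toℚᵘ (- (i / 1))        ∎′)
    where open ℚᵘ.≃-Reasoning renaming (begin_ to begin′_; _∎ to _∎′)

  ∑-cong : ∀ n {f g} → (∀ i → f i ≡ g i) → ∑< n f ≡ ∑< n g
  ∑-cong zero    f≗g = refl
  ∑-cong (suc n) f≗g = cong₂ _+_ (∑-cong n f≗g) (f≗g n)

  ∑-+ : ∀ n f g → ∑< n (λ i → f i + g i) ≡ ∑< n f + ∑< n g
  ∑-+ zero    f g = refl
  ∑-+ (suc n) f g = trans (cong (_+ (f n + g n)) (∑-+ n f g)) (lemma (∑< n f) (∑< n g) (f n) (g n))
    where
    lemma : ∀ a b c d → a + b + (c + d) ≡ a + c + (b + d)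
    lemma = solve-∀ ℚ-ring

  ∑-*ˡ : ∀ n c f → ∑< n (λ i → c * f i) ≡ c * ∑< n f
  ∑-*ˡ zero    c f = sym (ℚ.*-zeroʳ c)
  ∑-*ˡ (suc n) c f = trans (cong (_+ c * f n) (∑-*ˡ n c f)) (sym (ℚ.*-distribˡ-+ c (∑< n f) (f n)))

  inv! : ℕ → ℚ
  inv! m = (+ 1 / m !) {{m ℕ.!≢0}}

  inv!-suc : ∀ m → fromℕ (suc m) * inv! (suc m) ≡ inv! m
  inv!-suc m = *-cancelʳ (fromℕ (m !)) {{fromℕ≢0 (m !) {{m ℕ.!≢0}}}} (begin
    fromℕ (suc m) * inv! (suc m) * fromℕ (m !)
      ≡⟨ lemma (fromℕ (suc m)) (inv! (suc m)) (fromℕ (m !)) ⟩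
    inv! (suc m) * (fromℕ (suc m) * fromℕ (m !))
      ≡⟨ cong (inv! (suc m) *_) (fromℕ-* (suc m) (m !)) ⟨
    inv! (suc m) * fromℕ (suc m !)
      ≡⟨ /-*-cancel (+ 1) (suc m !) {{suc m ℕ.!≢0}} ⟩
    1ℚ
      ≡⟨ /-*-cancel (+ 1) (m !) {{m ℕ.!≢0}} ⟨
    inv! m * fromℕ (m !) ∎)
    where
    lemma : ∀ a b c → a * b * c ≡ b * (a * c)
    lemma = solve-∀ ℚ-ring

  falling-suc : ∀ x m → falling (x + 1ℚ) (suc m) ≡ (x + 1ℚ) * falling x m
  falling-suc x zero    = lemma x
    where
    lemma : ∀ x → 1ℚ * (x + 1ℚ - 0ℚ) ≡ (x + 1ℚ) * 1ℚ
    lemma = solve-∀ ℚ-ring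
  falling-suc x (suc m) = begin
    falling (x + 1ℚ) (suc m) * (x + 1ℚ - fromℕ (suc m))
      ≡⟨ cong₂ (λ f i → f * (x + 1ℚ - i)) (falling-suc x m) (fromℕ-suc m) ⟩
    (x + 1ℚ) * falling x m * (x + 1ℚ - (fromℕ m + 1ℚ))
      ≡⟨ lemma x (falling x m) (fromℕ m) ⟩
    (x + 1ℚ) * (falling x m * (x - fromℕ m)) ∎
    where
    lemma : ∀ x f m → (x + 1ℚ) * f * (x + 1ℚ - (m + 1ℚ)) ≡ (x + 1ℚ) * (f * (x - m))
    lemma = solve-∀ ℚ-ring

  binom-sucʳ : ∀ x m → fromℕ (suc m) * binom x (suc m) ≡ binom x m * (x - fromℕ m)
  binom-sucʳ x m = begin
    fromℕ (suc m) * (falling x m * (x - fromℕ m) * inv! (suc m))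
      ≡⟨ lemma (fromℕ (suc m)) (falling x m) (x - fromℕ m) (inv! (suc m)) ⟩
    falling x m * (fromℕ (suc m) * inv! (suc m)) * (x - fromℕ m)
      ≡⟨ cong (λ y → falling x m * y * (x - fromℕ m)) (inv!-suc m) ⟩
    falling x m * inv! m * (x - fromℕ m) ∎
    where
    lemma : ∀ a f y i → a * (f * y * i) ≡ f * (a * i) * y
    lemma = solve-∀ ℚ-ring

  binom-suc : ∀ x m → fromℕ (suc m) * binom (x + 1ℚ) (suc m) ≡ (x + 1ℚ) * binom x m
  binom-suc x m = begin
    fromℕ (suc m) * (falling (x + 1ℚ) (suc m) * inv! (suc m))
      ≡⟨ cong (λ f → fromℕ (suc m) * (f * inv! (suc m))) (falling-suc x m) ⟩
    fromℕ (suc m) * ((x + 1ℚ) * falling x m * inv! (suc m))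
      ≡⟨ lemma (fromℕ (suc m)) (x + 1ℚ) (falling x m) (inv! (suc m)) ⟩
    (x + 1ℚ) * (falling x m * (fromℕ (suc m) * inv! (suc m)))
      ≡⟨ cong (λ y → (x + 1ℚ) * (falling x m * y)) (inv!-suc m) ⟩
    (x + 1ℚ) * (falling x m * inv! m) ∎
    where
    lemma : ∀ a y f i → a * (y * f * i) ≡ y * (f * (a * i))
    lemma = solve-∀ ℚ-ring

  -- Along the diagonal, binom (n+β) n obeys a first-order recurrence whose coefficient n+1+β can be
  -- adjusted through β. `G`, `H`, `b` and the subtracted part of `Δ` are all instances.
  binom-suc-both : ∀ β n → fromℕ (suc n) * binom (fromℕ (suc n) + β) (suc n) ≡ (fromℕ n + 1ℚ + β) * binom (fromℕ n + β) n
  binom-suc-both β n = begin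
    fromℕ (suc n) * binom (fromℕ (suc n) + β) (suc n)
      ≡⟨ cong (λ x → fromℕ (suc n) * binom x (suc n)) shift ⟩
    fromℕ (suc n) * binom (fromℕ n + β + 1ℚ) (suc n)
      ≡⟨ binom-suc (fromℕ n + β) n ⟩
    (fromℕ n + β + 1ℚ) * binom (fromℕ n + β) n
      ≡⟨ cong (_* binom (fromℕ n + β) n) (lemma (fromℕ n) β) ⟨
    (fromℕ n + 1ℚ + β) * binom (fromℕ n + β) n ∎
    where
    lemma : ∀ n β → n + 1ℚ + β ≡ n + β + 1ℚ
    lemma = solve-∀ ℚ-ring
    shift : fromℕ (suc n) + β ≡ fromℕ n + β + 1ℚ
    shift = trans (cong (_+ β) (fromℕ-suc n)) (lemma (fromℕ n) β)

  sgn : ℕ → ℚ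
  sgn ℓ = -1ℤ ^ ℓ / 1

  sgn-suc : ∀ ℓ → sgn (suc ℓ) ≡ - sgn ℓ
  sgn-suc ℓ = trans (cong (_/ 1) (ℤ.-1*i≡-i (-1ℤ ^ ℓ))) (/1-neg (-1ℤ ^ ℓ))

  -- Partial alternating sums of a row telescope by Pascal's rule, which for rational x follows from
  -- `binom-suc` and `binom-sucʳ` after multiplication by j+1.
  ∑-alternating : ∀ x j → ∑< (suc j) (λ ℓ → binom (x + 1ℚ) ℓ * sgn ℓ) ≡ sgn j * binom x j
  ∑-alternating x zero    = refl
  ∑-alternating x (suc j) = *-cancelʳ (fromℕ (suc j)) {{fromℕ≢0 (suc j)}} (begin
    (∑< (suc j) (λ ℓ → binom (x + 1ℚ) ℓ * sgn ℓ) + binom (x + 1ℚ) (suc j) * sgn (suc j)) * fromℕ (suc j)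
      ≡⟨ cong₂ (λ s t → (s + binom (x + 1ℚ) (suc j) * t) * fromℕ (suc j)) (∑-alternating x j) (sgn-suc j) ⟩
    (sgn j * binom x j + binom (x + 1ℚ) (suc j) * - sgn j) * fromℕ (suc j)
      ≡⟨ lemma₁ (sgn j) (binom x j) (binom (x + 1ℚ) (suc j)) (fromℕ (suc j)) ⟩
    - sgn j * (fromℕ (suc j) * binom (x + 1ℚ) (suc j) - fromℕ (suc j) * binom x j)
      ≡⟨ cong₂ (λ y i → - sgn j * (y - i * binom x j)) (binom-suc x j) (fromℕ-suc j) ⟩
    - sgn j * ((x + 1ℚ) * binom x j - (fromℕ j + 1ℚ) * binom x j)
      ≡⟨ lemma₂ (sgn j) x (binom x j) (fromℕ j) ⟩
    - sgn j * (binom x j * (x - fromℕ j))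
      ≡⟨ cong (- sgn j *_) (binom-sucʳ x j) ⟨
    - sgn j * (fromℕ (suc j) * binom x (suc j))
      ≡⟨ cong (_* (fromℕ (suc j) * binom x (suc j))) (sgn-suc j) ⟨
    sgn (suc j) * (fromℕ (suc j) * binom x (suc j))
      ≡⟨ lemma₃ (sgn (suc j)) (fromℕ (suc j)) (binom x (suc j)) ⟩
    sgn (suc j) * binom x (suc j) * fromℕ (suc j) ∎)
    where
    lemma₁ : ∀ s a b i → (s * a + b * - s) * i ≡ - s * (i * b - i * a)
    lemma₁ = solve-∀ ℚ-ring
    lemma₂ : ∀ s x b j → - s * ((x + 1ℚ) * b - (j + 1ℚ) * b) ≡ - s * (b * (x - j))
    lemma₂ = solve-∀ ℚ-ring
    lemma₃ : ∀ s i b → s * (i * b) ≡ s * b * i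
    lemma₃ = solve-∀ ℚ-ring

  binom-out-of-range : ∀ m → binom (fromℕ m) (suc m) ≡ 0ℚ
  binom-out-of-range m = *-cancelʳ (fromℕ (suc m)) {{fromℕ≢0 (suc m)}} (begin
    binom (fromℕ m) (suc m) * fromℕ (suc m)   ≡⟨ ℚ.*-comm _ (fromℕ (suc m)) ⟩
    fromℕ (suc m) * binom (fromℕ m) (suc m)   ≡⟨ binom-sucʳ (fromℕ m) m ⟩
    binom (fromℕ m) m * (fromℕ m - fromℕ m)   ≡⟨ cong (binom (fromℕ m) m *_) (ℚ.+-inverseʳ (fromℕ m)) ⟩
    binom (fromℕ m) m * 0ℚ                    ≡⟨ ℚ.*-zeroʳ (binom (fromℕ m) m) ⟩
    0ℚ                                        ≡⟨ ℚ.*-zeroˡ (fromℕ (suc m)) ⟨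
    0ℚ * fromℕ (suc m)                        ∎)

  -- A complete row leaves the coefficient just beyond the end of the previous row, which is 0. In
  -- the recurrence this removes the leaf term for all sizes above 1.
  ∑-alternating-row : ∀ m → ∑< (suc (suc m)) (λ ℓ → binom (fromℕ (suc m)) ℓ * sgn ℓ) ≡ 0ℚ
  ∑-alternating-row m = begin
    ∑< (suc (suc m)) (λ ℓ → binom (fromℕ (suc m)) ℓ * sgn ℓ)
      ≡⟨ cong (λ x → ∑< (suc (suc m)) (λ ℓ → binom x ℓ * sgn ℓ)) (fromℕ-suc m) ⟩
    ∑< (suc (suc m)) (λ ℓ → binom (fromℕ m + 1ℚ) ℓ * sgn ℓ)
      ≡⟨ ∑-alternating (fromℕ m) (suc m) ⟩
    sgn (suc m) * binom (fromℕ m) (suc m)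
      ≡⟨ cong (sgn (suc m) *_) (binom-out-of-range m) ⟩
    sgn (suc m) * 0ℚ
      ≡⟨ ℚ.*-zeroʳ (sgn (suc m)) ⟩
    0ℚ ∎

  -- Both sides equal (ℓ+1) binom (m+1) (ℓ+1).
  binom-absorption : ∀ m ℓ → (fromℕ (suc m) - fromℕ ℓ) * binom (fromℕ (suc m)) ℓ ≡ fromℕ (suc m) * binom (fromℕ m) ℓ
  binom-absorption m ℓ = begin
    (fromℕ (suc m) - fromℕ ℓ) * binom (fromℕ (suc m)) ℓ
      ≡⟨ ℚ.*-comm (fromℕ (suc m) - fromℕ ℓ) _ ⟩
    binom (fromℕ (suc m)) ℓ * (fromℕ (suc m) - fromℕ ℓ)
      ≡⟨ binom-sucʳ (fromℕ (suc m)) ℓ ⟨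
    fromℕ (suc ℓ) * binom (fromℕ (suc m)) (suc ℓ)
      ≡⟨ cong (λ x → fromℕ (suc ℓ) * binom x (suc ℓ)) (fromℕ-suc m) ⟩
    fromℕ (suc ℓ) * binom (fromℕ m + 1ℚ) (suc ℓ)
      ≡⟨ binom-suc (fromℕ m) ℓ ⟩
    (fromℕ m + 1ℚ) * binom (fromℕ m) ℓ
      ≡⟨ cong (_* binom (fromℕ m) ℓ) (fromℕ-suc m) ⟨
    fromℕ (suc m) * binom (fromℕ m) ℓ ∎

  -- The recurrence for the expected number of nodes with m descendants.

  module _ (k : ℕ) where

    c α : ℚ
    c = fromℕ (suc k)
    α = + 1 / suc k

    α*c≡1 : α * c ≡ 1ℚ
    α*c≡1 = /-*-cancel (+ 1) (suc k)

    /suc-k : ∀ a → + a / suc k ≡ fromℕ a * α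
    /suc-k a = *-cancelʳ c {{fromℕ≢0 (suc k)}} (begin
      (+ a / suc k) * c     ≡⟨ /-*-cancel (+ a) (suc k) ⟩
      fromℕ a               ≡⟨ ℚ.*-identityʳ (fromℕ a) ⟨
      fromℕ a * 1ℚ          ≡⟨ cong (fromℕ a *_) α*c≡1 ⟨
      fromℕ a * (α * c)     ≡⟨ ℚ.*-assoc (fromℕ a) α c ⟨
      fromℕ a * α * c       ∎)

    k*α : fromℕ k * α ≡ 1ℚ - α
    k*α = begin
      fromℕ k * α                ≡⟨ lemma (fromℕ k) α ⟩
      α * (fromℕ k + 1ℚ) - α     ≡⟨ cong (λ x → α * x - α) (fromℕ-suc k) ⟨
      α * c - α                  ≡⟨ cong (_- α) α*c≡1 ⟩
      1ℚ - α                     ∎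
      where
      lemma : ∀ k α → k * α ≡ α * (k + 1ℚ) - α
      lemma = solve-∀ ℚ-ring

    k/suc-k : + k / suc k ≡ 1ℚ - α
    k/suc-k = trans (/suc-k k) k*α

    trees : ℕ → ℚ
    trees n = fromℕ (size (treeEnum k n))

    trees≢0 : ∀ n → NonZeroℚ (trees n)
    trees≢0 n = fromℕ≢0 (size (treeEnum k n)) {{size≢0 (treeEnum k n) (someTree k n)}}

    -- The expected number of nodes with m descendants.
    mean : ℕ → ℕ → ℚ
    mean n m = (+ subtrees k n m / size (treeEnum k n)) {{size≢0 (treeEnum k n) (someTree k n)}}

    mean*trees : ∀ n m → mean n m * trees n ≡ fromℕ (subtrees k n m)
    mean*trees n m = /-*-cancel (+ subtrees k n m) (size (treeEnum k n)) {{size≢0 (treeEnum k n) (someTree k n)}}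

    trees-suc : ∀ n → trees (suc n) ≡ trees n * (c * fromℕ n + 1ℚ)
    trees-suc n = begin
      fromℕ (size (treeEnum k (suc n)))              ≡⟨ cong fromℕ (size-trees-suc k n) ⟩
      fromℕ (size (treeEnum k n) ℕ.* suc (suc k ℕ.* n))
        ≡⟨ fromℕ-* (size (treeEnum k n)) (suc (suc k ℕ.* n)) ⟩
      trees n * fromℕ (suc (suc k ℕ.* n))            ≡⟨ cong (trees n *_) (fromℕ-suc (suc k ℕ.* n)) ⟩
      trees n * (fromℕ (suc k ℕ.* n) + 1ℚ)           ≡⟨ cong (λ x → trees n * (x + 1ℚ)) (fromℕ-* (suc k) n) ⟩
      trees n * (c * fromℕ n + 1ℚ)                   ∎

    law*n : ∀ n .{{_ : NonZero n}} m → law k n m * fromℕ n ≡ mean n m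
    law*n n m = *-cancelʳ (trees n) {{trees≢0 n}} (begin
      law k n m * fromℕ n * trees n
        ≡⟨ lemma (law k n m) (fromℕ n) (trees n) ⟩
      law k n m * (trees n * fromℕ n)
        ≡⟨ cong (law k n m *_) (trans (cong fromℕ (size-Ω k n)) (fromℕ-* (size (treeEnum k n)) n)) ⟨
      law k n m * fromℕ (size (ΩEnum k n))
        ≡⟨ /-*-cancel (+ subtrees k n m) (size (ΩEnum k n)) {{ΩEnum≢0 k n}} ⟩
      fromℕ (subtrees k n m)
        ≡⟨ mean*trees n m ⟨
      mean n m * trees n ∎)
      where
      lemma : ∀ l n t → l * n * t ≡ l * (t * n)
      lemma = solve-∀ ℚ-ring

    mean-0-descendants : ∀ n → mean n 0 ≡ 0ℚ
    mean-0-descendants n = *-cancelʳ (trees n) {{trees≢0 n}} (begin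
      mean n 0 * trees n       ≡⟨ mean*trees n 0 ⟩
      fromℕ (subtrees k n 0)   ≡⟨ cong fromℕ (subtrees-0 k n) ⟩
      0ℚ                       ≡⟨ ℚ.*-zeroˡ (trees n) ⟨
      0ℚ * trees n             ∎)

    mean-0-nodes : ∀ m → mean 0 m ≡ 0ℚ
    mean-0-nodes m = *-cancelʳ (trees 0) {{trees≢0 0}} (trans (mean*trees 0 m) (sym (ℚ.*-zeroˡ (trees 0))))

    -- Contribution of the newest node to size m+1. It computes to `1ℚ` at `zero` and to `0ℚ` at a
    -- successor, and later steps rely on this.
    new-leaf : ℕ → ℚ
    new-leaf m = fromℕ (𝟙 (1 ℕ.≟ suc m))

    -- `subtrees-suc` divided by `c` and by the number of trees: the total weight becomes n+α, the
    -- weight touching a subtree of size m becomes m-α, and the weight that avoids a subtree of size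
    -- m+1 is n+α-(m+1-α).
    mean-suc : ∀ n m →
      (fromℕ n + α) * mean (suc n) (suc m) ≡
      (fromℕ n + α) * new-leaf m + ((fromℕ n - 1ℚ - fromℕ m + α + α) * mean n (suc m) + (fromℕ m - α) * mean n m)
    mean-suc n m = *-cancelʳ (trees n) {{trees≢0 n}} (begin
      (N + α) * q′ * t
        -- To the ring solver `α` and `c` are independent variables, so `α * c` is put in place of
        -- `1ℚ` by hand and removed again at the end.
        ≡⟨ lemma₁ N α q′ t ⟩
      (1ℚ * N + α) * q′ * t
        ≡⟨ cong (λ u → (u * N + α) * q′ * t) α*c≡1 ⟨
      (α * c * N + α) * q′ * t
        ≡⟨ lemma₂ α c N q′ t ⟩
      α * (q′ * (t * (c * N + 1ℚ)))
        ≡⟨ cong (α *_) (+≡⇒≡- (+≡⇒≡- counts)) ⟩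
      α * (t * (c * N + 1ℚ) * d + ((c * N + (1ℚ + 1ℚ)) * (q₁ * t) + c * M * (q₀ * t)) - q₀ * t - c * (M + 1ℚ) * (q₁ * t))
        ≡⟨ lemma₃ α c t N M d q₁ q₀ ⟩
      ((α * c * N + α) * d + ((α * c * (N - 1ℚ - M) + α + α) * q₁ + (α * c * M - α) * q₀)) * t
        ≡⟨ cong (λ u → ((u * N + α) * d + ((u * (N - 1ℚ - M) + α + α) * q₁ + (u * M - α) * q₀)) * t) α*c≡1 ⟩
      ((1ℚ * N + α) * d + ((1ℚ * (N - 1ℚ - M) + α + α) * q₁ + (1ℚ * M - α) * q₀)) * t
        ≡⟨ lemma₄ α t N M d q₁ q₀ ⟩
      ((N + α) * d + ((N - 1ℚ - M + α + α) * q₁ + (M - α) * q₀)) * t ∎)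
      where
      N M t q′ q₁ q₀ d : ℚ
      N  = fromℕ n
      M  = fromℕ m
      t  = trees n
      q′ = mean (suc n) (suc m)
      q₁ = mean n (suc m)
      q₀ = mean n m
      d  = new-leaf m

      fromℕ-mult : ∀ a b j → fromℕ (suc k ℕ.* a ℕ.* subtrees k b j) ≡ c * fromℕ a * (mean b j * trees b)
      fromℕ-mult a b j = trans (fromℕ-* (suc k ℕ.* a) (subtrees k b j))
        (cong₂ _*_ (fromℕ-* (suc k) a) (sym (mean*trees b j)))

      counts : q′ * (t * (c * N + 1ℚ)) + c * (M + 1ℚ) * (q₁ * t) + q₀ * t ≡
               t * (c * N + 1ℚ) * d + ((c * N + (1ℚ + 1ℚ)) * (q₁ * t) + c * M * (q₀ * t))
      counts = begin
        q′ * (t * (c * N + 1ℚ)) + c * (M + 1ℚ) * (q₁ * t) + q₀ * t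
          ≡⟨ cong₂ (λ x y → q′ * x + c * y * (q₁ * t) + q₀ * t) (trees-suc n) (fromℕ-suc m) ⟨
        q′ * trees (suc n) + c * fromℕ (suc m) * (q₁ * t) + q₀ * t
          ≡⟨ cong₂ _+_ (cong₂ _+_ (mean*trees (suc n) (suc m)) (sym (fromℕ-mult (suc m) n (suc m)))) (mean*trees n m) ⟩
        fromℕ S′ + fromℕ (suc k ℕ.* suc m ℕ.* S₁) + fromℕ S₀
          ≡⟨ cong (_+ fromℕ S₀) (fromℕ-+ S′ (suc k ℕ.* suc m ℕ.* S₁)) ⟨
        fromℕ (S′ ℕ.+ suc k ℕ.* suc m ℕ.* S₁) + fromℕ S₀
          ≡⟨ fromℕ-+ (S′ ℕ.+ suc k ℕ.* suc m ℕ.* S₁) S₀ ⟨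
        fromℕ (S′ ℕ.+ suc k ℕ.* suc m ℕ.* S₁ ℕ.+ S₀)
          ≡⟨ cong fromℕ (subtrees-suc k n m) ⟩
        fromℕ (T′ ℕ.* δ ℕ.+ ((suc k ℕ.* n ℕ.+ 2) ℕ.* S₁ ℕ.+ suc k ℕ.* m ℕ.* S₀))
          ≡⟨ trans (fromℕ-+ (T′ ℕ.* δ) _) (cong₂ _+_ (fromℕ-* T′ δ) (fromℕ-+ ((suc k ℕ.* n ℕ.+ 2) ℕ.* S₁) (suc k ℕ.* m ℕ.* S₀))) ⟩
        trees (suc n) * d + (fromℕ ((suc k ℕ.* n ℕ.+ 2) ℕ.* S₁) + fromℕ (suc k ℕ.* m ℕ.* S₀))
          ≡⟨ cong₂ (λ x y → x * d + y) (trees-suc n) (cong₂ _+_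
               (trans (fromℕ-* (suc k ℕ.* n ℕ.+ 2) S₁)
                 (cong₂ _*_ (trans (fromℕ-+ (suc k ℕ.* n) 2) (cong (_+ fromℕ 2) (fromℕ-* (suc k) n))) (sym (mean*trees n (suc m)))))
               (fromℕ-mult m n m)) ⟩
        t * (c * N + 1ℚ) * d + ((c * N + fromℕ 2) * (q₁ * t) + c * M * (q₀ * t)) ∎
        where
        S′ S₁ S₀ T′ δ : ℕ
        S′ = subtrees k (suc n) (suc m)
        S₁ = subtrees k n (suc m)
        S₀ = subtrees k n m
        T′ = size (treeEnum k (suc n))
        δ  = 𝟙 (1 ℕ.≟ suc m)

      lemma₁ : ∀ N α q′ t → (N + α) * q′ * t ≡ (1ℚ * N + α) * q′ * t
      lemma₁ = solve-∀ ℚ-ring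
      lemma₂ : ∀ α c N q′ t → (α * c * N + α) * q′ * t ≡ α * (q′ * (t * (c * N + 1ℚ)))
      lemma₂ = solve-∀ ℚ-ring
      lemma₃ : ∀ α c t N M d q₁ q₀ →
        α * (t * (c * N + 1ℚ) * d + ((c * N + (1ℚ + 1ℚ)) * (q₁ * t) + c * M * (q₀ * t)) - q₀ * t - c * (M + 1ℚ) * (q₁ * t)) ≡
        ((α * c * N + α) * d + ((α * c * (N - 1ℚ - M) + α + α) * q₁ + (α * c * M - α) * q₀)) * t
      lemma₃ = solve-∀ ℚ-ring
      lemma₄ : ∀ α t N M d q₁ q₀ →
        ((1ℚ * N + α) * d + ((1ℚ * (N - 1ℚ - M) + α + α) * q₁ + (1ℚ * M - α) * q₀)) * t ≡
        ((N + α) * d + ((N - 1ℚ - M + α + α) * q₁ + (M - α) * q₀)) * t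
      lemma₄ = solve-∀ ℚ-ring

    -- Solution of the recurrence by an alternating sum.

    G H : ℕ → ℚ
    G n = binom (fromℕ n + α) n
    H n = binom (fromℕ n - + k / suc k) n

    -- This makes `H` an integrating factor: multiplied by `H n`, the left side of `mean-suc`
    -- becomes (n+1) times the value at n+1 of `mean` times `H`.
    H-suc : ∀ n → fromℕ (suc n) * H (suc n) ≡ (fromℕ n + α) * H n
    H-suc n = trans (binom-suc-both (- (+ k / suc k)) n) (cong (_* H n) (begin
      fromℕ n + 1ℚ - + k / suc k     ≡⟨ cong (λ x → fromℕ n + 1ℚ - x) k/suc-k ⟩
      fromℕ n + 1ℚ - (1ℚ - α)        ≡⟨ lemma (fromℕ n) α ⟩
      fromℕ n + α                    ∎))
      where
      lemma : ∀ n α → n + 1ℚ - (1ℚ - α) ≡ n + α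
      lemma = solve-∀ ℚ-ring

    -- Both sides equal (n+1) binom (n+α) (n+1), because n+α = (n+1) - k/(k+1). So the leaf term of
    -- `mean-suc`, once multiplied by `H n`, is a multiple of `G n`.
    α*G : ∀ n → α * G n ≡ (fromℕ n + α) * H n
    α*G n = begin
      α * G n
        ≡⟨ lemma₁ α (G n) (fromℕ n) ⟩
      G n * (fromℕ n + α - fromℕ n)
        ≡⟨ binom-sucʳ (fromℕ n + α) n ⟨
      fromℕ (suc n) * binom (fromℕ n + α) (suc n)
        ≡⟨ cong (λ x → fromℕ (suc n) * binom x (suc n)) (begin
             fromℕ n + α                     ≡⟨ lemma₂ (fromℕ n) α ⟩
             fromℕ n + 1ℚ - (1ℚ - α)         ≡⟨ cong₂ _-_ (fromℕ-suc n) k/suc-k ⟨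
             fromℕ (suc n) - + k / suc k     ∎) ⟩
      fromℕ (suc n) * H (suc n)
        ≡⟨ H-suc n ⟩
      (fromℕ n + α) * H n ∎
      where
      lemma₁ : ∀ α g n → α * g ≡ g * (n + α - n)
      lemma₁ = solve-∀ ℚ-ring
      lemma₂ : ∀ n α → n + α ≡ n + 1ℚ - (1ℚ - α)
      lemma₂ = solve-∀ ℚ-ring

    -- Chosen so that n+1+β ℓ = n-1-ℓ+2α, the diagonal coefficient of `mean-suc` at m = ℓ.
    β : ℕ → ℚ
    β ℓ = α + α - fromℕ ℓ - (1ℚ + 1ℚ)

    Δ : ℕ → ℕ → ℚ
    Δ n ℓ = G n - binom (fromℕ n - fromℕ ℓ - fromℕ 2 + + 2 / suc k) n

    Δ-β : ∀ n ℓ → Δ n ℓ ≡ G n - binom (fromℕ n + β ℓ) n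
    Δ-β n ℓ = cong (λ x → G n - binom x n) (begin
      fromℕ n - fromℕ ℓ - fromℕ 2 + + 2 / suc k
        ≡⟨ cong (λ x → fromℕ n - fromℕ ℓ - fromℕ 2 + x) (/suc-k 2) ⟩
      fromℕ n - fromℕ ℓ - (1ℚ + 1ℚ) + (1ℚ + 1ℚ) * α
        ≡⟨ lemma (fromℕ n) (fromℕ ℓ) α ⟩
      fromℕ n + β ℓ ∎)
      where
      lemma : ∀ n ℓ α → n - ℓ - (1ℚ + 1ℚ) + (1ℚ + 1ℚ) * α ≡ n + (α + α - ℓ - (1ℚ + 1ℚ))
      lemma = solve-∀ ℚ-ring

    -- The two binomials have the coefficients n+1+α and n+1+β ℓ; their difference ℓ+2-α is the
    -- strength with which `G` forces `Δ`.
    Δ-suc : ∀ n ℓ → fromℕ (suc n) * Δ (suc n) ℓ ≡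
            (fromℕ n - 1ℚ - fromℕ ℓ + α + α) * Δ n ℓ + (fromℕ ℓ + (1ℚ + 1ℚ) - α) * G n
    Δ-suc n ℓ = begin
      fromℕ (suc n) * Δ (suc n) ℓ
        ≡⟨ cong (fromℕ (suc n) *_) (Δ-β (suc n) ℓ) ⟩
      fromℕ (suc n) * (G (suc n) - B (suc n))
        ≡⟨ lemma₁ (fromℕ (suc n)) (G (suc n)) (B (suc n)) ⟩
      fromℕ (suc n) * G (suc n) - fromℕ (suc n) * B (suc n)
        ≡⟨ cong₂ _-_ (binom-suc-both α n) (binom-suc-both (β ℓ) n) ⟩
      (fromℕ n + 1ℚ + α) * G n - (fromℕ n + 1ℚ + β ℓ) * B n
        ≡⟨ lemma₂ (fromℕ n) (fromℕ ℓ) α (G n) (B n) ⟩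
      (fromℕ n - 1ℚ - fromℕ ℓ + α + α) * (G n - B n) + (fromℕ ℓ + (1ℚ + 1ℚ) - α) * G n
        ≡⟨ cong (λ x → (fromℕ n - 1ℚ - fromℕ ℓ + α + α) * x + (fromℕ ℓ + (1ℚ + 1ℚ) - α) * G n) (Δ-β n ℓ) ⟨
      (fromℕ n - 1ℚ - fromℕ ℓ + α + α) * Δ n ℓ + (fromℕ ℓ + (1ℚ + 1ℚ) - α) * G n ∎
      where
      B : ℕ → ℚ
      B n = binom (fromℕ n + β ℓ) n
      lemma₁ : ∀ n g b → n * (g - b) ≡ n * g - n * b
      lemma₁ = solve-∀ ℚ-ring
      lemma₂ : ∀ n ℓ α g b → (n + 1ℚ + α) * g - (n + 1ℚ + (α + α - ℓ - (1ℚ + 1ℚ))) * b ≡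
        (n - 1ℚ - ℓ + α + α) * (g - b) + (ℓ + (1ℚ + 1ℚ) - α) * g
      lemma₂ = solve-∀ ℚ-ring

    ι : ℕ → ℚ
    ι ℓ = -1ℤ ^ ℓ / (suc k ℕ.* suc ℓ ℕ.+ k)

    -- The denominator of `ι ℓ` is c(ℓ+2-α), so `ι ℓ` cancels the forcing coefficient of `Δ-suc` and
    -- only the sign remains.
    ι-sgn : ∀ ℓ → ι ℓ * (fromℕ ℓ + (1ℚ + 1ℚ) - α) ≡ α * sgn ℓ
    ι-sgn ℓ = begin
      ι ℓ * (fromℕ ℓ + (1ℚ + 1ℚ) - α)
        ≡⟨ lemma₁ (ι ℓ) (fromℕ ℓ) α ⟩
      ι ℓ * (1ℚ * (fromℕ ℓ + 1ℚ) + (1ℚ - α))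
        ≡⟨ cong₂ (λ x y → ι ℓ * (x * (fromℕ ℓ + 1ℚ) + y)) α*c≡1 k*α ⟨
      ι ℓ * (α * c * (fromℕ ℓ + 1ℚ) + fromℕ k * α)
        ≡⟨ lemma₂ (ι ℓ) α c (fromℕ ℓ) (fromℕ k) ⟩
      α * (ι ℓ * (c * (fromℕ ℓ + 1ℚ) + fromℕ k))
        ≡⟨ cong (λ x → α * (ι ℓ * x)) (begin
             fromℕ (suc k ℕ.* suc ℓ ℕ.+ k)           ≡⟨ fromℕ-+ (suc k ℕ.* suc ℓ) k ⟩
             fromℕ (suc k ℕ.* suc ℓ) + fromℕ k       ≡⟨ cong (_+ fromℕ k) (fromℕ-* (suc k) (suc ℓ)) ⟩
             c * fromℕ (suc ℓ) + fromℕ k             ≡⟨ cong (λ x → c * x + fromℕ k) (fromℕ-suc ℓ) ⟩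
             c * (fromℕ ℓ + 1ℚ) + fromℕ k            ∎) ⟨
      α * (ι ℓ * fromℕ (suc k ℕ.* suc ℓ ℕ.+ k))
        ≡⟨ cong (α *_) (/-*-cancel (-1ℤ ^ ℓ) (suc k ℕ.* suc ℓ ℕ.+ k)) ⟩
      α * sgn ℓ ∎
      where
      lemma₁ : ∀ ι ℓ α → ι * (ℓ + (1ℚ + 1ℚ) - α) ≡ ι * (1ℚ * (ℓ + 1ℚ) + (1ℚ - α))
      lemma₁ = solve-∀ ℚ-ring
      lemma₂ : ∀ ι α c ℓ k → ι * (α * c * (ℓ + 1ℚ) + k * α) ≡ α * (ι * (c * (ℓ + 1ℚ) + k))
      lemma₂ = solve-∀ ℚ-ring

    V : ℕ → ℕ → ℚ
    V n m = ∑[ ℓ < suc m ] binom (fromℕ m) ℓ * ι ℓ * Δ n ℓ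

    -- Both binomials in `Δ 0 ℓ` are 1, so each term vanishes by computation.
    V-0 : ∀ m → V 0 m ≡ 0ℚ
    V-0 m = trans (∑-cong (suc m) λ ℓ → lemma (binom (fromℕ m) ℓ * ι ℓ))
      (trans (∑-*ˡ (suc m) 0ℚ (λ _ → 0ℚ)) (ℚ.*-zeroˡ (∑< (suc m) (λ _ → 0ℚ))))
      where
      lemma : ∀ x → x * 0ℚ ≡ 0ℚ * 0ℚ
      lemma = solve-∀ ℚ-ring

    -- Each `Δ n ℓ` evolves with its own coefficient n-1-ℓ+2α. Taking out the one for ℓ = m leaves
    -- the excess m-ℓ, which absorption turns into the forcing by the smaller size; the `G` parts
    -- gather into an alternating row.
    V-suc : ∀ n m → fromℕ (suc n) * V (suc n) m ≡
      (fromℕ n - 1ℚ - fromℕ m + α + α) * V n m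
      + ∑< (suc m) (λ ℓ → (fromℕ m - fromℕ ℓ) * binom (fromℕ m) ℓ * ι ℓ * Δ n ℓ)
      + α * G n * ∑< (suc m) (λ ℓ → binom (fromℕ m) ℓ * sgn ℓ)
    V-suc n m = begin
      fromℕ (suc n) * V (suc n) m
        ≡⟨ ∑-*ˡ (suc m) (fromℕ (suc n)) _ ⟨
      ∑< (suc m) (λ ℓ → fromℕ (suc n) * (b ℓ * ι ℓ * Δ (suc n) ℓ))
        ≡⟨ ∑-cong (suc m) term ⟩
      ∑< (suc m) (λ ℓ → x * (b ℓ * ι ℓ * Δ n ℓ) + (fromℕ m - fromℕ ℓ) * b ℓ * ι ℓ * Δ n ℓ + α * G n * (b ℓ * sgn ℓ))
        ≡⟨ trans (∑-+ (suc m) _ _) (cong (_+ ∑< (suc m) (λ ℓ → α * G n * (b ℓ * sgn ℓ))) (∑-+ (suc m) _ _)) ⟩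
      ∑< (suc m) (λ ℓ → x * (b ℓ * ι ℓ * Δ n ℓ)) + W + ∑< (suc m) (λ ℓ → α * G n * (b ℓ * sgn ℓ))
        ≡⟨ cong₂ (λ y z → y + W + z) (∑-*ˡ (suc m) x _) (∑-*ˡ (suc m) (α * G n) _) ⟩
      x * V n m + W + α * G n * ∑< (suc m) (λ ℓ → b ℓ * sgn ℓ) ∎
      where
      b : ℕ → ℚ
      b = binom (fromℕ m)
      x W : ℚ
      x = fromℕ n - 1ℚ - fromℕ m + α + α
      W = ∑< (suc m) (λ ℓ → (fromℕ m - fromℕ ℓ) * b ℓ * ι ℓ * Δ n ℓ)
      lemma₁ : ∀ n b i d → n * (b * i * d) ≡ b * i * (n * d)
      lemma₁ = solve-∀ ℚ-ring
      lemma₂ : ∀ n m ℓ α b i d g → b * i * ((n - 1ℚ - ℓ + α + α) * d + (ℓ + (1ℚ + 1ℚ) - α) * g) ≡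
        (n - 1ℚ - m + α + α) * (b * i * d) + (m - ℓ) * b * i * d + i * (ℓ + (1ℚ + 1ℚ) - α) * b * g
      lemma₂ = solve-∀ ℚ-ring
      lemma₃ : ∀ α s b g → α * s * b * g ≡ α * g * (b * s)
      lemma₃ = solve-∀ ℚ-ring
      term : ∀ ℓ → fromℕ (suc n) * (b ℓ * ι ℓ * Δ (suc n) ℓ) ≡
        x * (b ℓ * ι ℓ * Δ n ℓ) + (fromℕ m - fromℕ ℓ) * b ℓ * ι ℓ * Δ n ℓ + α * G n * (b ℓ * sgn ℓ)
      term ℓ = begin
        fromℕ (suc n) * (b ℓ * ι ℓ * Δ (suc n) ℓ)
          ≡⟨ lemma₁ (fromℕ (suc n)) (b ℓ) (ι ℓ) (Δ (suc n) ℓ) ⟩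
        b ℓ * ι ℓ * (fromℕ (suc n) * Δ (suc n) ℓ)
          ≡⟨ cong (b ℓ * ι ℓ *_) (Δ-suc n ℓ) ⟩
        b ℓ * ι ℓ * ((fromℕ n - 1ℚ - fromℕ ℓ + α + α) * Δ n ℓ + (fromℕ ℓ + (1ℚ + 1ℚ) - α) * G n)
          ≡⟨ lemma₂ (fromℕ n) (fromℕ m) (fromℕ ℓ) α (b ℓ) (ι ℓ) (Δ n ℓ) (G n) ⟩
        x * (b ℓ * ι ℓ * Δ n ℓ) + (fromℕ m - fromℕ ℓ) * b ℓ * ι ℓ * Δ n ℓ + ι ℓ * (fromℕ ℓ + (1ℚ + 1ℚ) - α) * b ℓ * G n
          ≡⟨ cong (λ y → x * (b ℓ * ι ℓ * Δ n ℓ) + (fromℕ m - fromℕ ℓ) * b ℓ * ι ℓ * Δ n ℓ + y)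
               (trans (cong (λ y → y * b ℓ * G n) (ι-sgn ℓ)) (lemma₃ α (sgn ℓ) (b ℓ) (G n))) ⟩
        x * (b ℓ * ι ℓ * Δ n ℓ) + (fromℕ m - fromℕ ℓ) * b ℓ * ι ℓ * Δ n ℓ + α * G n * (b ℓ * sgn ℓ) ∎

    -- The factor m+1-ℓ kills the last term and lowers the row of the binomials in all the others.
    ∑-absorbed : ∀ n m →
      ∑< (suc (suc m)) (λ ℓ → (fromℕ (suc m) - fromℕ ℓ) * binom (fromℕ (suc m)) ℓ * ι ℓ * Δ n ℓ) ≡ fromℕ (suc m) * V n m
    ∑-absorbed n m = begin
      ∑< (suc m) f + f (suc m)
        ≡⟨ cong₂ _+_ (∑-cong (suc m) inner) last ⟩
      ∑< (suc m) (λ ℓ → fromℕ (suc m) * (binom (fromℕ m) ℓ * ι ℓ * Δ n ℓ)) + 0ℚ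
        ≡⟨ trans (ℚ.+-identityʳ _) (∑-*ˡ (suc m) (fromℕ (suc m)) _) ⟩
      fromℕ (suc m) * V n m ∎
      where
      f : ℕ → ℚ
      f ℓ = (fromℕ (suc m) - fromℕ ℓ) * binom (fromℕ (suc m)) ℓ * ι ℓ * Δ n ℓ
      lemma₁ : ∀ m b i d → m * b * i * d ≡ m * (b * i * d)
      lemma₁ = solve-∀ ℚ-ring
      lemma₂ : ∀ m b i d → (m - m) * b * i * d ≡ 0ℚ
      lemma₂ = solve-∀ ℚ-ring
      inner : ∀ ℓ → f ℓ ≡ fromℕ (suc m) * (binom (fromℕ m) ℓ * ι ℓ * Δ n ℓ)
      inner ℓ = trans (cong (λ x → x * ι ℓ * Δ n ℓ) (binom-absorption m ℓ))
        (lemma₁ (fromℕ (suc m)) (binom (fromℕ m) ℓ) (ι ℓ) (Δ n ℓ))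
      last : f (suc m) ≡ 0ℚ
      last = lemma₂ (fromℕ (suc m)) (binom (fromℕ (suc m)) (suc m)) (ι (suc m)) (Δ n (suc m))

    -- The ratio (m+1-α)/(m+1) of consecutive values matches the transition coefficient of
    -- `mean-suc` with the factor m+1 from `∑-absorbed`.
    b : ℕ → ℚ
    b m = binom (fromℕ m - α) m

    b-suc : ∀ m → fromℕ (suc m) * b (suc m) ≡ (fromℕ (suc m) - α) * b m
    b-suc m = trans (binom-suc-both (- α) m) (cong (λ x → (x - α) * b m) (sym (fromℕ-suc m)))

    -- b m * V n m obeys the recurrence of mean n (suc m) * H n.
    closed-form : ∀ n m → mean n (suc m) * H n ≡ b m * V n m
    closed-form zero m = begin
      mean 0 (suc m) * 1ℚ    ≡⟨ cong (_* 1ℚ) (mean-0-nodes (suc m)) ⟩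
      0ℚ * 1ℚ                ≡⟨⟩
      0ℚ                     ≡⟨ ℚ.*-zeroʳ (b m) ⟨
      b m * 0ℚ               ≡⟨ cong (b m *_) (V-0 m) ⟨
      b m * V 0 m            ∎
    closed-form (suc n) m = *-cancelʳ (fromℕ (suc n)) {{fromℕ≢0 (suc n)}} (begin
      mean (suc n) (suc m) * H (suc n) * N′
        ≡⟨ lemma₁ (mean (suc n) (suc m)) (H (suc n)) N′ ⟩
      mean (suc n) (suc m) * (N′ * H (suc n))
        ≡⟨ cong (mean (suc n) (suc m) *_) (H-suc n) ⟩
      mean (suc n) (suc m) * ((fromℕ n + α) * H n)
        ≡⟨ lemma₂ (mean (suc n) (suc m)) (fromℕ n + α) (H n) ⟩
      (fromℕ n + α) * mean (suc n) (suc m) * H n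
        ≡⟨ cong (_* H n) (mean-suc n m) ⟩
      ((fromℕ n + α) * new-leaf m + (x m * mean n (suc m) + (fromℕ m - α) * mean n m)) * H n
        ≡⟨ lemma₃ (fromℕ n + α) (new-leaf m) (x m) (mean n (suc m)) (fromℕ m - α) (mean n m) (H n) ⟩
      x m * (mean n (suc m) * H n) + ((fromℕ m - α) * (mean n m * H n) + (fromℕ n + α) * H n * new-leaf m)
        ≡⟨ cong₂ (λ y z → x m * y + ((fromℕ m - α) * (mean n m * H n) + z * new-leaf m)) (closed-form n m) (sym (α*G n)) ⟩
      x m * (b m * V n m) + ((fromℕ m - α) * (mean n m * H n) + α * G n * new-leaf m)
        ≡⟨ cong (λ y → x m * (b m * V n m) + y) (boundary m) ⟩
      x m * (b m * V n m) + (b m * W m + b m * (α * G n * A m))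
        ≡⟨ lemma₄ (x m) (b m) (V n m) (W m) (α * G n * A m) ⟩
      b m * (x m * V n m + W m + α * G n * A m)
        ≡⟨ cong (b m *_) (V-suc n m) ⟨
      b m * (N′ * V (suc n) m)
        ≡⟨ lemma₅ (b m) N′ (V (suc n) m) ⟩
      b m * V (suc n) m * N′ ∎)
      where
      N′ : ℚ
      N′ = fromℕ (suc n)
      x W A : ℕ → ℚ
      x m = fromℕ n - 1ℚ - fromℕ m + α + α
      W m = ∑< (suc m) (λ ℓ → (fromℕ m - fromℕ ℓ) * binom (fromℕ m) ℓ * ι ℓ * Δ n ℓ)
      A m = ∑< (suc m) (λ ℓ → binom (fromℕ m) ℓ * sgn ℓ)
      lemma₁ : ∀ q h n → q * h * n ≡ q * (n * h)
      lemma₁ = solve-∀ ℚ-ring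
      lemma₂ : ∀ q a h → q * (a * h) ≡ a * q * h
      lemma₂ = solve-∀ ℚ-ring
      lemma₃ : ∀ a d x q₁ y q₀ h → (a * d + (x * q₁ + y * q₀)) * h ≡ x * (q₁ * h) + (y * (q₀ * h) + a * h * d)
      lemma₃ = solve-∀ ℚ-ring
      lemma₄ : ∀ x b v w a → x * (b * v) + (b * w + b * a) ≡ b * (x * v + w + a)
      lemma₄ = solve-∀ ℚ-ring
      lemma₅ : ∀ b n v → b * (n * v) ≡ b * v * n
      lemma₅ = solve-∀ ℚ-ring
      lemma₆ : ∀ α h g i d → (0ℚ - α) * (0ℚ * h) + g * 1ℚ ≡ 1ℚ * (0ℚ + (0ℚ - 0ℚ) * 1ℚ * i * d) + 1ℚ * (g * 1ℚ)
      lemma₆ = solve-∀ ℚ-ring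
      lemma₇ : ∀ y b v g → y * (b * v) + g * 0ℚ ≡ y * b * v
      lemma₇ = solve-∀ ℚ-ring
      lemma₈ : ∀ m b v g → m * b * v ≡ b * (m * v) + b * (g * 0ℚ)
      lemma₈ = solve-∀ ℚ-ring
      -- At m = 0 the leaf term is matched by `A 0`, which is 1, and `mean n 0` vanishes. At m+1 the
      -- leaf term and the alternating row both vanish, and the induction hypothesis for the smaller
      -- size matches `W`.
      boundary : ∀ m → (fromℕ m - α) * (mean n m * H n) + α * G n * new-leaf m ≡ b m * W m + b m * (α * G n * A m)
      boundary zero = trans (cong (λ q → (0ℚ - α) * (q * H n) + α * G n * 1ℚ) (mean-0-descendants n))
        (lemma₆ α (H n) (α * G n) (ι 0) (Δ n 0))
      boundary (suc m) = begin
        (fromℕ (suc m) - α) * (mean n (suc m) * H n) + α * G n * 0ℚ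
          ≡⟨ cong (λ y → (fromℕ (suc m) - α) * y + α * G n * 0ℚ) (closed-form n m) ⟩
        (fromℕ (suc m) - α) * (b m * V n m) + α * G n * 0ℚ
          ≡⟨ lemma₇ (fromℕ (suc m) - α) (b m) (V n m) (α * G n) ⟩
        (fromℕ (suc m) - α) * b m * V n m
          ≡⟨ cong (_* V n m) (b-suc m) ⟨
        fromℕ (suc m) * b (suc m) * V n m
          ≡⟨ lemma₈ (fromℕ (suc m)) (b (suc m)) (V n m) (α * G n) ⟩
        b (suc m) * (fromℕ (suc m) * V n m) + b (suc m) * (α * G n * 0ℚ)
          ≡⟨ cong₂ (λ y z → b (suc m) * y + b (suc m) * (α * G n * z)) (∑-absorbed n m) (∑-alternating-row m) ⟨
        b (suc m) * W (suc m) + b (suc m) * (α * G n * A (suc m)) ∎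

    law-formula : ∀ n .{{_ : NonZero n}} m .{{_ : NonZero m}} →
      law k n m ≡
        (binom (fromℕ m - 1ℚ - + 1 / suc k) (pred m) ÷ (fromℕ n * H n)) {{lawDenominator≢0 k n}}
        * (∑[ ℓ < m ]
            binom (fromℕ m - 1ℚ) ℓ * (-1ℤ ^ ℓ / (suc k ℕ.* suc ℓ ℕ.+ k)) * Δ n ℓ)
    law-formula n (suc m) = begin
      law k n (suc m)
        ≡⟨ *-1/-cancel (law k n (suc m)) D {{lawDenominator≢0 k n}} ⟨
      law k n (suc m) * D * 1/D
        ≡⟨ cong (_* 1/D) (begin
             law k n (suc m) * (fromℕ n * H n)     ≡⟨ ℚ.*-assoc (law k n (suc m)) (fromℕ n) (H n) ⟨
             law k n (suc m) * fromℕ n * H n       ≡⟨ cong (_* H n) (law*n n (suc m)) ⟩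
             mean n (suc m) * H n                  ≡⟨ closed-form n m ⟩
             b m * V n m                           ∎) ⟩
      b m * V n m * 1/D
        ≡⟨ lemma (b m) (V n m) 1/D ⟩
      b m * 1/D * V n m
        ≡⟨ cong (λ x → binom (x - α) m * 1/D * (∑[ ℓ < suc m ] binom x ℓ * ι ℓ * Δ n ℓ)) shift ⟩
      binom (fromℕ (suc m) - 1ℚ - α) m * 1/D * (∑[ ℓ < suc m ] binom (fromℕ (suc m) - 1ℚ) ℓ * ι ℓ * Δ n ℓ) ∎
      where
      D 1/D : ℚ
      D   = fromℕ n * H n
      1/D = (1/ D) {{lawDenominator≢0 k n}}
      lemma : ∀ b v d → b * v * d ≡ b * d * v
      lemma = solve-∀ ℚ-ring
      lemma′ : ∀ m → m ≡ m + 1ℚ - 1ℚ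
      lemma′ = solve-∀ ℚ-ring
      shift : fromℕ m ≡ fromℕ (suc m) - 1ℚ
      shift = trans (lemma′ (fromℕ m)) (cong (_- 1ℚ) (sym (fromℕ-suc m)))

open ClosedForm

-- Convergence at rate 1/n.

module Limit where

  open ℚ.≤-Reasoning

  -- A nonnegative fraction is at most its numerator, since its denominator is at least 1.
  archimedean : ∀ p → ∃[ n ] p ≤ fromℕ n
  archimedean p@(mkℚ (+ a) d _) = a , ℚ.toℚᵘ-cancel-≤
    (ℚᵘ.≤-respʳ-≃ (ℚᵘ.≃-sym (ℚ.toℚᵘ-fromℚᵘ (ℚᵘ.mkℚᵘ (+ a) 0)))
      (ℚᵘ.*≤* (subst₂ ℤ._≤_ (ℤ.pos-* a 1) (ℤ.pos-* a (suc d)) (ℤ.+≤+ (ℕ.*-monoʳ-≤ a (ℕ.s≤s ℕ.z≤n))))))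
  archimedean p@(mkℚ -[1+ a ] d _) = 0 , ℚ.nonPositive⁻¹ p

  ∣p∣*r : ∀ p {r} → 0ℚ ≤ r → ∣ p ∣ * r ≡ ∣ p * r ∣
  ∣p∣*r p {r} 0≤r = trans (cong (∣ p ∣ *_) (sym (ℚ.0≤p⇒∣p∣≡p 0≤r))) (sym (ℚ.∣p*q∣≡∣p∣*∣q∣ p r))

  -- Every limit below is obtained from an error bound C/n, kept free of division by multiplying the
  -- error by n.
  rate⇒⟶ : ∀ (s : (n : ℕ) .{{_ : NonZero n}} → ℚ) L N₀ C →
    (∀ n .{{_ : NonZero n}} → N₀ ℕ.≤ n → ∣ (s n - L) * fromℕ n ∣ ≤ C) → s ⟶ L
  rate⇒⟶ s L N₀ C bound ε 0<ε with archimedean ((C ÷ ε) {{ℚ.pos⇒nonZero ε {{positive 0<ε}}}})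
  -- With a ≥ C/ε, the extra successor makes the bound strict: C ≤ aε < (a+1)ε ≤ nε.
  ... | a , C/ε≤a = N₀ ℕ.+ suc a , λ n N≤n → ℚ.*-cancelʳ-<-nonNeg (fromℕ n) {{nonNegative (0≤fromℕ n)}} (begin-strict
    ∣ s n - L ∣ * fromℕ n        ≡⟨ ∣p∣*r (s n - L) (0≤fromℕ n) ⟩
    ∣ (s n - L) * fromℕ n ∣      ≤⟨ bound n (ℕ.≤-trans (ℕ.m≤m+n N₀ (suc a)) N≤n) ⟩
    C                            ≡⟨ undo ⟨
    (C ÷ ε) * ε                  ≤⟨ ℚ.*-monoʳ-≤-nonNeg ε {{ℚ.pos⇒nonNeg ε}} C/ε≤a ⟩
    fromℕ a * ε                  ≡⟨ ℚ.*-comm (fromℕ a) ε ⟩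
    ε * fromℕ a                  <⟨ ℚ.*-monoʳ-<-pos ε a<1+a ⟩
    ε * fromℕ (suc a)            ≤⟨ ℚ.*-monoˡ-≤-nonNeg ε {{ℚ.pos⇒nonNeg ε}} (fromℕ-mono (ℕ.≤-trans (ℕ.m≤n+m (suc a) N₀) N≤n)) ⟩
    ε * fromℕ n                  ∎)
    where
    instance
      ε>0 : Positive ε
      ε>0 = positive 0<ε
      ε≢0 : NonZeroℚ ε
      ε≢0 = ℚ.pos⇒nonZero ε
    undo : (C ÷ ε) * ε ≡ C
    undo = trans (ℚ.*-assoc C (1/ ε) ε) (trans (cong (C *_) (ℚ.*-inverseˡ ε)) (ℚ.*-identityʳ C))
    a<1+a : fromℕ a < fromℕ (suc a)
    a<1+a = subst₂ _<_ (ℚ.+-identityʳ (fromℕ a)) (sym (fromℕ-suc a)) (ℚ.+-monoʳ-< (fromℕ a) (ℚ.positive⁻¹ 1ℚ))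

  -- A distribution function on ℕ sees x only through `floor x`: it is a partial sum, or 0 when x is
  -- negative.
  ∑-⟶⇒⟶ᵈ : ∀ {νs : (n : ℕ) .{{_ : NonZero n}} → ℕ → ℚ} {ν} →
    (∀ t → (λ n → ∑< (suc t) (νs n)) ⟶ ∑< (suc t) ν) → (λ n → νs n) ⟶ᵈ ν
  ∑-⟶⇒⟶ᵈ {νs} {ν} ∑-⟶ x _ with floor x
  ... | + t      = ∑-⟶ t
  ... | -[1+ _ ] = rate⇒⟶ (λ _ → 0ℚ) 0ℚ 0 0ℚ λ n _ → ℚ.≤-reflexive (cong ∣_∣ (ℚ.*-zeroˡ (fromℕ n)))

  -- The limit law and its partial sums.

  module _ (k : ℕ) .{{_ : NonZero k}} where

    private
      a : ℚ
      a = α k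

    μ : ℕ → ℚ
    μ zero      = 0ℚ
    μ m@(suc _) = (fromℕ k ÷ (fromℕ (suc k) * (fromℕ m + + k / suc k) * (fromℕ m - + 1 / suc k))) {{limitDenominator≢0 k m}}

    -- Up to the factor `c`, the weight of the cliques touching a subtree of size t+1. Moreover
    -- `s (suc t)` and `s t` are the two nonconstant factors in the denominator of `μ (suc t)`.
    s : ℕ → ℚ
    s t = fromℕ (suc t) - a

    α<1 : a < 1ℚ
    α<1 = /<1 1 k (ℕ.s≤s (ℕ.>-nonZero⁻¹ k))

    0<s : ∀ t → 0ℚ < s t
    0<s t = subst (0ℚ <_) (ℚ.+-identityʳ (s t)) (gap a 0 (suc t) α<1 (ℕ.s≤s ℕ.z≤n))

    s≢0 : ∀ t → NonZeroℚ (s t)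
    s≢0 t = ℚ.pos⇒nonZero (s t) {{positive (0<s t)}}

    s-suc : ∀ t → s (suc t) ≡ s t + 1ℚ
    s-suc t = trans (cong (_- a) (fromℕ-suc (suc t))) (lemma (fromℕ (suc t)) a)
      where
      lemma : ∀ t a → t + 1ℚ - a ≡ t - a + 1ℚ
      lemma = solve-∀ ℚ-ring

    -- The denominator is `c` times both factors, because k/(k+1) = 1-α, and the numerator k divided
    -- by `c` is again 1-α.
    μ*s*s : ∀ t → μ (suc t) * (s (suc t) * s t) ≡ 1ℚ - a
    μ*s*s t = begin-equality
      μ (suc t) * (s (suc t) * s t)
        ≡⟨ cong (λ x → μ (suc t) * (x * s t)) (begin-equality
             s (suc t)                      ≡⟨ s-suc t ⟩
             fromℕ (suc t) - a + 1ℚ         ≡⟨ lemma₁ (fromℕ (suc t)) a ⟩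
             fromℕ (suc t) + (1ℚ - a)       ≡⟨ cong (λ x → fromℕ (suc t) + x) (k/suc-k k) ⟨
             u                              ∎) ⟩
      μ (suc t) * (u * s t)
        ≡⟨ lemma₂ (μ (suc t)) (u * s t) ⟩
      1ℚ * (μ (suc t) * (u * s t))
        ≡⟨ cong (_* (μ (suc t) * (u * s t))) (α*c≡1 k) ⟨
      a * c k * (μ (suc t) * (u * s t))
        ≡⟨ lemma₃ a (c k) (μ (suc t)) u (s t) ⟩
      μ (suc t) * (c k * u * s t) * a
        ≡⟨ cong (_* a) undo ⟩
      fromℕ k * a
        ≡⟨ k*α k ⟩
      1ℚ - a ∎
      where
      u D : ℚ
      u = fromℕ (suc t) + + k / suc k
      D = c k * u * s t
      lemma₁ : ∀ t a → t - a + 1ℚ ≡ t + (1ℚ - a)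
      lemma₁ = solve-∀ ℚ-ring
      lemma₂ : ∀ m x → m * x ≡ 1ℚ * (m * x)
      lemma₂ = solve-∀ ℚ-ring
      lemma₃ : ∀ a c m u s → a * c * (m * (u * s)) ≡ m * (c * u * s) * a
      lemma₃ = solve-∀ ℚ-ring
      undo : μ (suc t) * D ≡ fromℕ k
      undo = trans (ℚ.*-assoc (fromℕ k) ((1/ D) {{limitDenominator≢0 k (suc t)}}) D)
        (trans (cong (fromℕ k *_) (ℚ.*-inverseˡ D {{limitDenominator≢0 k (suc t)}})) (ℚ.*-identityʳ (fromℕ k)))

    μ-nonNegative : ∀ m → 0ℚ ≤ μ m
    μ-nonNegative zero    = ℚ.≤-refl
    μ-nonNegative (suc t) = ℚ.*-cancelʳ-≤-pos (s (suc t) * s t) {{pos}} (begin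
      0ℚ * (s (suc t) * s t)            ≡⟨ ℚ.*-zeroˡ (s (suc t) * s t) ⟩
      0ℚ                                <⟨ 0<⇒< α<1 ⟩
      1ℚ - a                            ≡⟨ μ*s*s t ⟨
      μ (suc t) * (s (suc t) * s t)     ∎)
      where
      pos : Positive (s (suc t) * s t)
      pos = ℚ.pos*pos⇒pos (s (suc t)) {{positive (0<s (suc t))}} (s t) {{positive (0<s t)}}

    M : ℕ → ℚ
    M t = ∑[ m < suc t ] μ m

    -- Since μ (t+1) = (1-α)(1/s t - 1/s (t+1)), the sums telescope to 1 - (1-α)/s t = t/s t.
    M*s : ∀ t → M t * s t ≡ fromℕ t
    M*s zero    = trans (cong (_* s 0) (ℚ.+-identityʳ 0ℚ)) (ℚ.*-zeroˡ (s 0))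
    M*s (suc t) = *-cancelʳ (s t) {{s≢0 t}} (begin-equality
      (M t + μ (suc t)) * s (suc t) * s t
        ≡⟨ lemma₁ (M t) (μ (suc t)) (s (suc t)) (s t) ⟩
      M t * s t * s (suc t) + μ (suc t) * (s (suc t) * s t)
        ≡⟨ cong₂ _+_ (cong₂ _*_ (M*s t) (s-suc t)) (μ*s*s t) ⟩
      fromℕ t * (fromℕ (suc t) - a + 1ℚ) + (1ℚ - a)
        ≡⟨ cong (λ x → fromℕ t * (x - a + 1ℚ) + (1ℚ - a)) (fromℕ-suc t) ⟩
      fromℕ t * (fromℕ t + 1ℚ - a + 1ℚ) + (1ℚ - a)
        ≡⟨ lemma₂ (fromℕ t) a ⟩
      (fromℕ t + 1ℚ) * (fromℕ t + 1ℚ - a)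
        ≡⟨ cong (λ x → x * (x - a)) (fromℕ-suc t) ⟨
      fromℕ (suc t) * s t ∎)
      where
      lemma₁ : ∀ M m s′ s → (M + m) * s′ * s ≡ M * s * s′ + m * (s′ * s)
      lemma₁ = solve-∀ ℚ-ring
      lemma₂ : ∀ t a → t * (t + 1ℚ - a + 1ℚ) + (1ℚ - a) ≡ (t + 1ℚ) * (t + 1ℚ - a)
      lemma₂ = solve-∀ ℚ-ring

    M-1 : ∀ t → (M t - 1ℚ) * s t ≡ a - 1ℚ
    M-1 t = begin-equality
      (M t - 1ℚ) * s t                ≡⟨ lemma₁ (M t) (s t) ⟩
      M t * s t - s t                 ≡⟨ cong₂ (λ x y → x - (y - a)) (M*s t) (fromℕ-suc t) ⟩
      fromℕ t - (fromℕ t + 1ℚ - a)    ≡⟨ lemma₂ (fromℕ t) a ⟩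
      a - 1ℚ                          ∎
      where
      lemma₁ : ∀ M s → (M - 1ℚ) * s ≡ M * s - s
      lemma₁ = solve-∀ ℚ-ring
      lemma₂ : ∀ t a → t - (t + 1ℚ - a) ≡ a - 1ℚ
      lemma₂ = solve-∀ ℚ-ring

    -- Both sides equal (1-α)/s (t+1). This is the balance equation under which (n+α) M t solves the
    -- recurrence for cumulative counts.
    s*μ : ∀ t → s t * μ (suc t) ≡ 1ℚ - M (suc t)
    s*μ t = *-cancelʳ (s (suc t)) {{s≢0 (suc t)}} (begin-equality
      s t * μ (suc t) * s (suc t)            ≡⟨ lemma₁ (s t) (μ (suc t)) (s (suc t)) ⟩
      μ (suc t) * (s (suc t) * s t)          ≡⟨ μ*s*s t ⟩
      1ℚ - a                                 ≡⟨ lemma₂ a ⟩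
      - (a - 1ℚ)                             ≡⟨ cong -_ (M-1 (suc t)) ⟨
      - ((M (suc t) - 1ℚ) * s (suc t))       ≡⟨ lemma₃ (M (suc t)) (s (suc t)) ⟩
      (1ℚ - M (suc t)) * s (suc t)           ∎)
      where
      lemma₁ : ∀ s m s′ → s * m * s′ ≡ m * (s′ * s)
      lemma₁ = solve-∀ ℚ-ring
      lemma₂ : ∀ a → 1ℚ - a ≡ - (a - 1ℚ)
      lemma₂ = solve-∀ ℚ-ring
      lemma₃ : ∀ M s → - ((M - 1ℚ) * s) ≡ (1ℚ - M) * s
      lemma₃ = solve-∀ ℚ-ring

    0≤α : 0ℚ ≤ a
    0≤α = ℚ.nonNegative⁻¹ a {{ℚ.normalize-nonNeg 1 (suc k)}}

    total : (λ n → ∑[ m < n ] μ m) ⟶ 1ℚ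
    -- The error is (1-α)/s t with n = t+1; the constant 1 works because (1-α) n ≤ n-α for n ≥ 1.
    total = rate⇒⟶ (λ n → ∑< n μ) 1ℚ 0 1ℚ λ { n@(suc t) _ → ℚ.*-cancelʳ-≤-pos (s t) {{positive (0<s t)}} (begin
      ∣ (M t - 1ℚ) * fromℕ n ∣ * s t
        ≡⟨ ∣p∣*r ((M t - 1ℚ) * fromℕ n) (ℚ.<⇒≤ (0<s t)) ⟩
      ∣ (M t - 1ℚ) * fromℕ n * s t ∣
        ≡⟨ cong ∣_∣ (trans (lemma₁ (M t - 1ℚ) (fromℕ n) (s t)) (trans (cong (_* fromℕ n) (M-1 t)) (lemma₂ a (fromℕ n)))) ⟩
      ∣ - ((1ℚ - a) * fromℕ n) ∣
        ≡⟨ ℚ.∣-p∣≡∣p∣ ((1ℚ - a) * fromℕ n) ⟩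
      ∣ (1ℚ - a) * fromℕ n ∣
        ≡⟨ ∣p∣*r (1ℚ - a) (0≤fromℕ n) ⟨
      ∣ 1ℚ - a ∣ * fromℕ n
        ≡⟨ cong (_* fromℕ n) (ℚ.0≤p⇒∣p∣≡p (ℚ.<⇒≤ (0<⇒< α<1))) ⟩
      (1ℚ - a) * fromℕ n
        ≡⟨ lemma₃ a (fromℕ n) ⟩
      fromℕ n + - (a * fromℕ n)
        ≤⟨ ℚ.+-monoʳ-≤ (fromℕ n) (ℚ.neg-antimono-≤ (begin
             a               ≡⟨ ℚ.*-identityʳ a ⟨
             a * 1ℚ          ≤⟨ ℚ.*-monoˡ-≤-nonNeg a {{nonNegative 0≤α}} (fromℕ-mono {1} {n} (ℕ.s≤s ℕ.z≤n)) ⟩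
             a * fromℕ n     ∎)) ⟩
      fromℕ n - a
        ≡⟨ ℚ.*-identityˡ (fromℕ n - a) ⟨
      1ℚ * s t ∎) }
      where
      lemma₁ : ∀ x n s → x * n * s ≡ x * s * n
      lemma₁ = solve-∀ ℚ-ring
      lemma₂ : ∀ a n → (a - 1ℚ) * n ≡ - ((1ℚ - a) * n)
      lemma₂ = solve-∀ ℚ-ring
      lemma₃ : ∀ a n → (1ℚ - a) * n ≡ n + - (a * n)
      lemma₃ = solve-∀ ℚ-ring

    -- Cumulative expected counts and their bounded deviation.

    Q : ℕ → ℕ → ℚ
    Q n t = ∑[ m < suc t ] mean k n m

    -- Summation of `mean-suc` cancels the transitions inside the range of sizes; what is left is
    -- the loss `s t` from size t+1, and one new leaf per step.
    Q-suc : ∀ n t → (fromℕ n + a) * Q (suc n) (suc t) ≡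
      (fromℕ n + a) + ((fromℕ n + a - s t) * Q n (suc t) + s t * Q n t)
    Q-suc n zero = begin-equality
      (N + a) * (0ℚ + q′ 0 + q′ 1)
        ≡⟨ cong (λ x → (N + a) * (0ℚ + x + q′ 1)) (mean-0-descendants k (suc n)) ⟩
      (N + a) * (0ℚ + 0ℚ + q′ 1)
        ≡⟨ lemma₁ (N + a) (q′ 1) ⟩
      (N + a) * q′ 1
        ≡⟨ mean-suc k n 0 ⟩
      (N + a) * 1ℚ + ((N - 1ℚ - 0ℚ + a + a) * q 1 + (0ℚ - a) * q 0)
        ≡⟨ cong (λ x → (N + a) * 1ℚ + ((N - 1ℚ - 0ℚ + a + a) * q 1 + (0ℚ - a) * x)) (mean-0-descendants k n) ⟩
      (N + a) * 1ℚ + ((N - 1ℚ - 0ℚ + a + a) * q 1 + (0ℚ - a) * 0ℚ)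
        ≡⟨ lemma₂ N a (q 1) ⟩
      (N + a) + ((N + a - (1ℚ - a)) * (0ℚ + 0ℚ + q 1) + (1ℚ - a) * (0ℚ + 0ℚ))
        ≡⟨ cong (λ x → (N + a) + ((N + a - (1ℚ - a)) * (0ℚ + x + q 1) + (1ℚ - a) * (0ℚ + x))) (mean-0-descendants k n) ⟨
      (N + a) + ((N + a - s 0) * (0ℚ + q 0 + q 1) + s 0 * (0ℚ + q 0)) ∎
      where
      N : ℚ
      N = fromℕ n
      q q′ : ℕ → ℚ
      q  = mean k n
      q′ = mean k (suc n)
      lemma₁ : ∀ x q → x * (0ℚ + 0ℚ + q) ≡ x * q
      lemma₁ = solve-∀ ℚ-ring
      lemma₂ : ∀ N a q → (N + a) * 1ℚ + ((N - 1ℚ - 0ℚ + a + a) * q + (0ℚ - a) * 0ℚ) ≡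
        (N + a) + ((N + a - (1ℚ - a)) * (0ℚ + 0ℚ + q) + (1ℚ - a) * (0ℚ + 0ℚ))
      lemma₂ = solve-∀ ℚ-ring
    Q-suc n (suc t) = begin-equality
      (N + a) * (Q (suc n) (suc t) + mean k (suc n) (suc (suc t)))
        ≡⟨ ℚ.*-distribˡ-+ (N + a) (Q (suc n) (suc t)) (mean k (suc n) (suc (suc t))) ⟩
      (N + a) * Q (suc n) (suc t) + (N + a) * mean k (suc n) (suc (suc t))
        ≡⟨ cong₂ _+_ (Q-suc n t) (mean-suc k n (suc t)) ⟩
      (N + a) + ((N + a - s t) * (Q n t + q₁) + s t * Q n t) + ((N + a) * 0ℚ + ((N - 1ℚ - fromℕ (suc t) + a + a) * q₂ + (fromℕ (suc t) - a) * q₁))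
        ≡⟨ lemma N a (fromℕ (suc t)) (Q n t) q₁ q₂ ⟩
      (N + a) + ((N + a - (s t + 1ℚ)) * (Q n t + q₁ + q₂) + (s t + 1ℚ) * (Q n t + q₁))
        ≡⟨ cong (λ x → (N + a) + ((N + a - x) * (Q n t + q₁ + q₂) + x * (Q n t + q₁))) (s-suc t) ⟨
      (N + a) + ((N + a - s (suc t)) * Q n (suc (suc t)) + s (suc t) * Q n (suc t)) ∎
      where
      N q₁ q₂ : ℚ
      N  = fromℕ n
      q₁ = mean k n (suc t)
      q₂ = mean k n (suc (suc t))
      lemma : ∀ N a T Q q₁ q₂ →
        (N + a) + ((N + a - (T - a)) * (Q + q₁) + (T - a) * Q) + ((N + a) * 0ℚ + ((N - 1ℚ - T + a + a) * q₂ + (T - a) * q₁)) ≡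
        (N + a) + ((N + a - (T - a + 1ℚ)) * (Q + q₁ + q₂) + (T - a + 1ℚ) * (Q + q₁))
      lemma = solve-∀ ℚ-ring

    -- (n + α) M t solves the recurrence of Q exactly, so that F obeys the
    -- homogeneous one, a convex combination as soon as t < n.
    F : ℕ → ℕ → ℚ
    F n t = Q n t - (fromℕ n + a) * M t

    F-suc : ∀ n t → (fromℕ n + a) * F (suc n) (suc t) ≡ (fromℕ n + a - s t) * F n (suc t) + s t * F n t
    F-suc n t = begin-equality
      (N + a) * (Q (suc n) (suc t) - (fromℕ (suc n) + a) * M (suc t))
        ≡⟨ cong (λ x → (N + a) * (Q (suc n) (suc t) - (x + a) * M (suc t))) (fromℕ-suc n) ⟩
      (N + a) * (Q (suc n) (suc t) - (N + 1ℚ + a) * M (suc t))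
        ≡⟨ lemma₁ N a (Q (suc n) (suc t)) (M (suc t)) ⟩
      (N + a) * Q (suc n) (suc t) - (N + a) * (N + 1ℚ + a) * M (suc t)
        ≡⟨ cong (_- (N + a) * (N + 1ℚ + a) * M (suc t)) (Q-suc n t) ⟩
      (N + a) + ((N + a - s t) * Q n (suc t) + s t * Q n t) - (N + a) * (N + 1ℚ + a) * M (suc t)
        ≡⟨ lemma₂ N a (s t) (Q n (suc t)) (Q n t) (M (suc t)) ⟩
      (N + a) * (1ℚ - M (suc t)) + ((N + a - s t) * Q n (suc t) + s t * Q n t - (N + a) * (N + a) * M (suc t))
        -- The limit law enters here: the leftover inhomogeneity (n+α)(1 - M (t+1)) is exactly the
        -- change of the comparison solution between levels t and t+1.
        ≡⟨ cong (λ x → (N + a) * x + ((N + a - s t) * Q n (suc t) + s t * Q n t - (N + a) * (N + a) * M (suc t))) (s*μ t) ⟨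
      (N + a) * (s t * μ (suc t)) + ((N + a - s t) * Q n (suc t) + s t * Q n t - (N + a) * (N + a) * M (suc t))
        ≡⟨ lemma₃ N a (s t) (Q n (suc t)) (Q n t) (M t) (μ (suc t)) ⟩
      (N + a - s t) * F n (suc t) + s t * F n t ∎
      where
      N : ℚ
      N = fromℕ n
      lemma₁ : ∀ N a q m → (N + a) * (q - (N + 1ℚ + a) * m) ≡ (N + a) * q - (N + a) * (N + 1ℚ + a) * m
      lemma₁ = solve-∀ ℚ-ring
      lemma₂ : ∀ N a s q′ q m → (N + a) + ((N + a - s) * q′ + s * q) - (N + a) * (N + 1ℚ + a) * m ≡
        (N + a) * (1ℚ - m) + ((N + a - s) * q′ + s * q - (N + a) * (N + a) * m)
      lemma₂ = solve-∀ ℚ-ring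
      lemma₃ : ∀ N a s q′ q m μ → (N + a) * (s * μ) + ((N + a - s) * q′ + s * q - (N + a) * (N + a) * (m + μ)) ≡
        (N + a - s) * (q′ - (N + a) * (m + μ)) + s * (q - (N + a) * m)
      lemma₃ = solve-∀ ℚ-ring

    F-0 : ∀ n → F n 0 ≡ 0ℚ
    F-0 n = trans (cong (λ x → 0ℚ + x - (fromℕ n + a) * (0ℚ + 0ℚ)) (mean-0-descendants k n)) (lemma (fromℕ n + a))
      where
      lemma : ∀ x → 0ℚ + 0ℚ - x * (0ℚ + 0ℚ) ≡ 0ℚ
      lemma = solve-∀ ℚ-ring

    -- Induction on n, starting at n = t+1: by `F-suc` each new value is a convex combination of the
    -- previous value at level t+1 and a value at level t. The sum of the starting value and `C`
    -- dominates both.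
    F-bounded-suc : ∀ t C → (∀ n → t ℕ.≤ n → ∣ F n t ∣ ≤ C) →
      ∀ n → suc t ℕ.≤ n → ∣ F n (suc t) ∣ ≤ ∣ F (suc t) (suc t) ∣ + C
    F-bounded-suc t C bound n₀ t<n₀ = subst (λ n → ∣ F n (suc t) ∣ ≤ C′) (ℕ.m∸n+n≡m t<n₀) (go (n₀ ℕ.∸ suc t))
      where
      C′ : ℚ
      C′ = ∣ F (suc t) (suc t) ∣ + C
      0≤C : 0ℚ ≤ C
      0≤C = ℚ.≤-trans (ℚ.0≤∣p∣ (F t t)) (bound t ℕ.≤-refl)
      C≤C′ : C ≤ C′
      C≤C′ = subst (_≤ C′) (ℚ.+-identityˡ C) (ℚ.+-monoˡ-≤ C (ℚ.0≤∣p∣ (F (suc t) (suc t))))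
      go : ∀ j → ∣ F (j ℕ.+ suc t) (suc t) ∣ ≤ C′
      go zero    = subst (_≤ C′) (ℚ.+-identityʳ _) (ℚ.+-monoʳ-≤ ∣ F (suc t) (suc t) ∣ 0≤C)
      go (suc j) = ℚ.*-cancelʳ-≤-pos (N + a) {{N+a>0}} (begin
        ∣ F (suc n) (suc t) ∣ * (N + a)
          ≡⟨ ∣p∣*r (F (suc n) (suc t)) (ℚ.<⇒≤ (ℚ.positive⁻¹ (N + a) {{N+a>0}})) ⟩
        ∣ F (suc n) (suc t) * (N + a) ∣
          ≡⟨ cong ∣_∣ (trans (ℚ.*-comm (F (suc n) (suc t)) (N + a)) (F-suc n t)) ⟩
        ∣ r * F n (suc t) + s t * F n t ∣
          ≤⟨ ℚ.∣p+q∣≤∣p∣+∣q∣ (r * F n (suc t)) (s t * F n t) ⟩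
        ∣ r * F n (suc t) ∣ + ∣ s t * F n t ∣
          ≤⟨ ℚ.+-mono-≤ (scaled r 0≤r (F n (suc t)) (go j))
               (scaled (s t) (ℚ.<⇒≤ (0<s t)) (F n t) (ℚ.≤-trans (bound n (ℕ.≤-trans (ℕ.n≤1+n t) (ℕ.m≤n+m (suc t) j))) C≤C′)) ⟩
        C′ * r + C′ * s t
          ≡⟨ lemma C′ (N + a) (s t) ⟩
        C′ * (N + a) ∎)
        where
        n : ℕ
        n = j ℕ.+ suc t
        N r : ℚ
        N = fromℕ n
        r = N + a - s t
        N+a>0 : Positive (N + a)
        N+a>0 = ℚ.nonNeg+pos⇒pos N {{nonNegative (0≤fromℕ n)}} a {{/-pos 1 (suc k)}}
        -- Here n ≥ t+1 is used: n+α-(t+1-α) is nonnegative because -α ≤ α.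
        0≤r : 0ℚ ≤ r
        0≤r = begin
          0ℚ                            ≡⟨ ℚ.+-inverseʳ (s t) ⟨
          fromℕ (suc t) + - a - s t     ≤⟨ ℚ.+-monoˡ-≤ (- s t) (ℚ.+-mono-≤ (fromℕ-mono (ℕ.m≤n+m (suc t) j))
                                             (ℚ.≤-trans (ℚ.neg-antimono-≤ 0≤α) 0≤α)) ⟩
          N + a - s t                   ∎
        scaled : ∀ x → 0ℚ ≤ x → ∀ y → ∣ y ∣ ≤ C′ → ∣ x * y ∣ ≤ C′ * x
        scaled x 0≤x y ∣y∣≤C′ = begin
          ∣ x * y ∣    ≡⟨ cong ∣_∣ (ℚ.*-comm x y) ⟩
          ∣ y * x ∣    ≡⟨ ∣p∣*r y 0≤x ⟨
          ∣ y ∣ * x    ≤⟨ ℚ.*-monoʳ-≤-nonNeg x {{nonNegative 0≤x}} ∣y∣≤C′ ⟩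
          C′ * x       ∎
        lemma : ∀ C w s → C * (w - s) + C * s ≡ C * w
        lemma = solve-∀ ℚ-ring

    F-bounded : ∀ t → ∃[ C ] ∀ n → t ℕ.≤ n → ∣ F n t ∣ ≤ C
    F-bounded zero    = 0ℚ , λ n _ → ℚ.≤-reflexive (cong ∣_∣ (F-0 n))
    F-bounded (suc t) = let C , bound = F-bounded t in
      ∣ F (suc t) (suc t) ∣ + C , F-bounded-suc t C bound

    ∑-law*n : ∀ n .{{_ : NonZero n}} t → ∑< t (law k n) * fromℕ n ≡ ∑< t (mean k n)
    ∑-law*n n zero    = ℚ.*-zeroˡ (fromℕ n)
    ∑-law*n n (suc t) = trans (ℚ.*-distribʳ-+ (fromℕ n) (∑< t (law k n)) (law k n t)) (cong₂ _+_ (∑-law*n n t) (law*n k n t))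

    -- `F` compares with (n+α) M t, whereas the law is normalised by n. The discrepancy α M t does
    -- not depend on n and is added to the bound.
    ∑-law-⟶ : ∀ t → (λ n → ∑[ m < suc t ] law k n m) ⟶ M t
    ∑-law-⟶ t = let C , bound = F-bounded t in rate⇒⟶ (λ n → ∑< (suc t) (law k n)) (M t) t (C + ∣ a * M t ∣) λ n t≤n → begin
      ∣ (∑< (suc t) (law k n) - M t) * fromℕ n ∣
        ≡⟨ cong ∣_∣ (trans (lemma₁ (∑< (suc t) (law k n)) (M t) (fromℕ n))
             (trans (cong (_- M t * fromℕ n) (∑-law*n n (suc t))) (lemma₂ (Q n t) (M t) (fromℕ n) a))) ⟩
      ∣ F n t + a * M t ∣
        ≤⟨ ℚ.∣p+q∣≤∣p∣+∣q∣ (F n t) (a * M t) ⟩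
      ∣ F n t ∣ + ∣ a * M t ∣
        ≤⟨ ℚ.+-monoˡ-≤ ∣ a * M t ∣ (bound n t≤n) ⟩
      C + ∣ a * M t ∣ ∎
      where
      lemma₁ : ∀ l m n → (l - m) * n ≡ l * n - m * n
      lemma₁ = solve-∀ ℚ-ring
      lemma₂ : ∀ q m n a → q - m * n ≡ q - (n + a) * m + a * m
      lemma₂ = solve-∀ ℚ-ring

open Limit

theorem6 : ∀ (k : ℕ) .{{_ : NonZero k}} →
    (∀ (n : ℕ) .{{_ : NonZero n}} (m : ℕ) .{{_ : NonZero m}} →
    law k n m ≡
    (binom (fromℕ m - 1ℚ - + 1 / suc k) (pred m) ÷ (fromℕ n * binom (fromℕ n - + k / suc k) n)) {{lawDenominator≢0 k n}}
    * (∑[ ℓ < m ]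
    binom (fromℕ m - 1ℚ) ℓ * (-1ℤ ^ ℓ / (suc k ℕ.* suc ℓ ℕ.+ k))
    * (binom (fromℕ n + + 1 / suc k) n
    - binom (fromℕ n - fromℕ ℓ - fromℕ 2 + + 2 / suc k) n)))
    × (Σ[ μ ∈ (ℕ → ℚ) ]
    IsProbabilityMass μ
    × (∀ (m : ℕ) .{{_ : NonZero m}} →
    μ m ≡ (fromℕ k ÷ (fromℕ (suc k) * (fromℕ m + + k / suc k) * (fromℕ m - + 1 / suc k))) {{limitDenominator≢0 k m}})
    × ((λ n → law k n) ⟶ᵈ μ))
theorem6 k =
  law-formula k ,
  μ k ,
  record { nonNegative = μ-nonNegative k ; total = total k } ,
  (λ where (suc _) → refl) ,
  ∑-⟶⇒⟶ᵈ (∑-law-⟶ k)
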